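{- Let $k$ be a nonnegative integer, let $\mathbf u=u_1+u_2+\cdots+u_k$, and for $\mathfrak a=(\pi,\phi)\in\mathsf A_n^k$ let $$\mathrm{col}(\mathfrak a)=\prod_{i\in\mathsf{Fix}(\pi)}u_{\phi(i)}.$$ Let $\mathcal C_{\mathbf u}(z)$ be the continued fraction $\mathcal C(z)$ with $\mathbf u$ substituted for $u$. Then $$\mathcal C_{\mathbf u}(z)=\sum_{n\ge0}\sum_{\mathfrak a=(\sigma,\phi)\in\mathsf A_n^k}\mathrm{col}(\mathfrak a)\,a^{\mathsf{ile}(\sigma)} b^{\mathsf{nile}(\sigma)} c^{\mathsf{ie}(\sigma)-\mathsf{ile}(\sigma)} d^{\mathsf{nie}(\sigma)-\mathsf{nile}(\sigma)} f^{\mathsf{ilae}(\sigma)} g^{\mathsf{nilae}(\sigma)} h^{\mathsf{iae}(\sigma)-\mathsf{ilae}(\sigma)} \ell^{\mathsf{niae}(\sigma)-\mathsf{nilae}(\sigma)}\, p^{\mathsf{exc}(\sigma)-\mathsf{le}(\sigma)} r^{\mathsf{aexc}(\sigma)-\mathsf{lae}(\sigma)} s^{\mathsf{le}(\sigma)} t^{\mathsf{lae}(\sigma)} w^{\mathsf{iefp}(\sigma)} z^n .$$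
   Context: $[n]=\{1,\dots,n\}$, $\mathcal S_n$ is the set of permutations of $[n]$, and $\mathsf{Fix}(\pi)$ is the set of fixed points of $\pi$. A $k$-arrangement of $[n]$ is a pair $\mathfrak a=(\pi,\phi)$ with $\pi\in\mathcal S_n$ and $\phi:\mathsf{Fix}(\pi)\to[k]$ an arbitrary map (for $k=0$: a derangement, i.e. a fixed-point-free permutation); the set of these is $\mathsf A_n^k$, and $\mathsf A_0^k$ consists of the empty word only. An empty sum is $0$, an empty product is $1$, and $0^0=1$. For $n\ge1$, $[n]_{x,y}:=\sum_{i=0}^{n-1}x^{n-1-i}y^{i}$, and $[0]_{x,y}:=0$. For parameters $a,b,c,d,f,g,h,\ell,p,r,s,t,u,w$, $\mathcal C(z)$ is the formal power series in $z$ defined by the continued fraction $$\mathcal C(z)=\cfrac{1}{1-\alpha_0z-\cfrac{\beta_1z^2}{1-\alpha_1z-\cfrac{\beta_2z^2}{\ddots}}},\qquad \alpha_n=u\,w^n+s\,[n]_{a,b}+t\,[n]_{f,g}\ (n\ge 0),\quad \beta_n=p\,r\,[n]_{c,d}\,[n]_{h,\ell}\ (n\ge 1).$$ For $\sigma\in\mathcal S_n$ (indices $i$, and ordered pairs $(i,j)$, range over $[n]$): - $\mathsf{exc}(\sigma)=\#\{i: i<\sigma(i)\}$, $\mathsf{aexc}(\sigma)=\#\{i: i>\sigma(i)\}$; - $\mathsf{le}(\sigma)=\#\{i:\sigma^{ -1}(i)<i<\sigma(i)\}$, $\mathsf{lae}(\sigma)=\#\{i:\sigma^{ -1}(i)>i>\sigma(i)\}$;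 - $\mathsf{ie}(\sigma)=\#\{(i,j): i<j<\sigma(j)<\sigma(i)\}$, $\mathsf{ile}(\sigma)=\#\{(i,j): i<j<\sigma(j)<\sigma(i),\ \sigma^{ -1}(j)<j\}$; - $\mathsf{nie}(\sigma)=\#\{(i,j): i<j<\sigma(i)<\sigma(j)\}$, $\mathsf{nile}(\sigma)=\#\{(i,j): i<j<\sigma(i)<\sigma(j),\ \sigma^{ -1}(j)<j\}$; - $\mathsf{iae}(\sigma)=\#\{(i,j): j>i>\sigma(i)>\sigma(j)\}$, $\mathsf{ilae}(\sigma)=\#\{(i,j): j>i>\sigma(i)>\sigma(j),\ \sigma^{ -1}(i)>i\}$; - $\mathsf{niae}(\sigma)=\#\{(i,j): j>i>\sigma(j)>\sigma(i)\}$, $\mathsf{nilae}(\sigma)=\#\{(i,j): j>i>\sigma(j)>\sigma(i),\ \sigma^{ -1}(i)>i\}$; - $\mathsf{iefp}(\sigma)=\#\{(i,j): i<j=\sigma(j)<\sigma(i)\}$. -}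

module Defs where

open import Algebra.Bundles using (CommutativeRing; Semiring)
open import Axiom.UniquenessOfIdentityProofs using (module Decidable⇒UIP)
open import Data.Fin.Base as Fin using (Fin; zero; suc; toℕ)
open import Data.Fin.Permutation as Perm using (Permutation′; _⟨$⟩ʳ_; _⟨$⟩ˡ_)
open import Data.Fin.Properties using (_≟_; _<?_; ∀-cons; punchIn-injective; toℕ<n)
open import Data.List.Base as List
  using (List; []; _∷_; [_]; length; filter; allFin; cartesianProduct; cartesianProductWith; concatMap; foldr)
open import Data.List.Membership.Propositional.Properties using (∈-allFin)
open import Data.List.Relation.Binary.Disjoint.Setoid using (Disjoint)
open import Data.List.Relation.Binary.Sublist.Propositional using (⊆-refl)
import Data.List.Relation.Binary.Sublist.Propositional.Properties as Sublistₚ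
open import Data.List.Relation.Unary.All as All using ([]; _∷_)
import Data.List.Relation.Unary.All.Properties as Allₚ
open import Data.List.Relation.Unary.AllPairs as AllPairs using ([]; _∷_)
import Data.List.Relation.Unary.AllPairs.Properties as AllPairsₚ
open import Data.List.Relation.Unary.Any as Any using (Any; here; there)
import Data.List.Relation.Unary.Any.Properties as Anyₚ
open import Data.List.Relation.Unary.Enumerates.Setoid using (IsEnumeration)
open import Data.List.Relation.Unary.Unique.Setoid using (Unique)
import Data.List.Relation.Unary.Unique.Setoid.Properties as Uniqueₚ
open import Data.List.Relation.Unary.Unique.Propositional.Properties using (allFin⁺)
open import Data.Nat.Base as ℕ using (ℕ; zero; suc; z≤n; s≤s; _∸_)
import Data.Nat.Properties as ℕₚ
open import Data.Product using (∃; _×_; _,_; proj₁; proj₂; uncurry)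
import Data.Vec.Functional as Vector
open import Function.Base using (_∘_; const)
open import Level using (0ℓ)
open import Relation.Binary.Bundles using (Setoid)
open import Relation.Binary.PropositionalEquality as ≡ using (_≡_; cong)
open import Relation.Nullary using (Dec; yes; no; ¬_; contradiction)
open import Relation.Nullary.Decidable using (_×-dec_)
open import Relation.Unary using (Pred; Decidable)

private
  variable
    n k : ℕ

#₁ : {P : Pred (Fin n) 0ℓ} → Decidable P → ℕ
#₁ P? = length (filter P? (allFin _))

#₂ : {P : Fin n → Fin n → Set} → (∀ i j → Dec (P i j)) → ℕ
#₂ P? = length (filter (uncurry P?) (cartesianProduct (allFin _) (allFin _)))

-- The index set [n] is represented by Fin n, i.e. shifted to {0, …, n-1};
-- the statistics only compare indices.
module _ {n} (σ : Permutation′ n) where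
  private
    σ⁺ σ⁻ : Fin n → Fin n
    σ⁺ i = σ ⟨$⟩ʳ i
    σ⁻ i = σ ⟨$⟩ˡ i

  exc aexc le lae ie ile nie nile iae ilae niae nilae iefp : ℕ
  exc   = #₁ λ i → i <? σ⁺ i
  aexc  = #₁ λ i → σ⁺ i <? i
  le    = #₁ λ i → σ⁻ i <? i ×-dec i <? σ⁺ i
  lae   = #₁ λ i → i <? σ⁻ i ×-dec σ⁺ i <? i
  ie    = #₂ λ i j → i <? j ×-dec j <? σ⁺ j ×-dec σ⁺ j <? σ⁺ i
  ile   = #₂ λ i j → (i <? j ×-dec j <? σ⁺ j ×-dec σ⁺ j <? σ⁺ i) ×-dec σ⁻ j <? j
  nie   = #₂ λ i j → i <? j ×-dec j <? σ⁺ i ×-dec σ⁺ i <? σ⁺ j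
  nile  = #₂ λ i j → (i <? j ×-dec j <? σ⁺ i ×-dec σ⁺ i <? σ⁺ j) ×-dec σ⁻ j <? j
  iae   = #₂ λ i j → i <? j ×-dec σ⁺ i <? i ×-dec σ⁺ j <? σ⁺ i
  ilae  = #₂ λ i j → (i <? j ×-dec σ⁺ i <? i ×-dec σ⁺ j <? σ⁺ i) ×-dec i <? σ⁻ i
  niae  = #₂ λ i j → i <? j ×-dec σ⁺ j <? i ×-dec σ⁺ i <? σ⁺ j
  nilae = #₂ λ i j → (i <? j ×-dec σ⁺ j <? i ×-dec σ⁺ i <? σ⁺ j) ×-dec i <? σ⁻ i
  iefp  = #₂ λ i j → i <? j ×-dec j ≟ σ⁺ j ×-dec σ⁺ j <? σ⁺ i

filter-length-mono : ∀ {A : Set} {P Q : Pred A 0ℓ} (P? : Decidable P) (Q? : Decidable Q) →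
                     (∀ {x} → P x → Q x) → ∀ xs →
                     length (filter P? xs) ℕ.≤ length (filter Q? xs)
filter-length-mono P? Q? P⇒Q xs =
  Sublistₚ.length-mono-≤ (Sublistₚ.filter⁺ P? Q? (λ { ≡.refl → P⇒Q }) (⊆-refl {x = xs}))

-- Hence truncated subtraction computes exc - le, ie - ile, … correctly.
module _ {n} (σ : Permutation′ n) where

  le≤exc : le σ ℕ.≤ exc σ
  le≤exc = filter-length-mono _ _ proj₂ (allFin n)

  lae≤aexc : lae σ ℕ.≤ aexc σ
  lae≤aexc = filter-length-mono _ _ proj₂ (allFin n)

  ile≤ie : ile σ ℕ.≤ ie σ
  ile≤ie = filter-length-mono _ _ proj₁ (cartesianProduct (allFin n) (allFin n))

  nile≤nie : nile σ ℕ.≤ nie σ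
  nile≤nie = filter-length-mono _ _ proj₁ (cartesianProduct (allFin n) (allFin n))

  ilae≤iae : ilae σ ℕ.≤ iae σ
  ilae≤iae = filter-length-mono _ _ proj₁ (cartesianProduct (allFin n) (allFin n))

  nilae≤niae : nilae σ ℕ.≤ niae σ
  nilae≤niae = filter-length-mono _ _ proj₁ (cartesianProduct (allFin n) (allFin n))

Fix : Permutation′ n → Set
Fix π = ∃ λ i → π ⟨$⟩ʳ i ≡ i

record Arrangement (n k : ℕ) : Set where
  constructor _,_
  field
    perm   : Permutation′ n
    colour : Fix perm → Fin k

open Arrangement public

permutations : ∀ n → List (Permutation′ n)
permutations zero    = [ Perm.id ]
permutations (suc n) = cartesianProductWith (Perm.insert zero) (allFin (suc n)) (permutations n)

ifHolds : {P A : Set} → Dec P → List A → List (P → A)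
ifHolds (yes _) xs = List.map const xs
ifHolds (no ¬p) xs = [ (λ p → contradiction p ¬p) ]

choices : {B : Fin n → Set} → (∀ i → List (B i)) → List (∀ i → B i)
choices {zero}  xss = [ (λ ()) ]
choices {suc n} xss = cartesianProductWith ∀-cons (xss zero) (choices (xss ∘ suc))

colourings : ∀ k (π : Permutation′ n) → List (Fix π → Fin k)
colourings k π = List.map uncurry (choices λ i → ifHolds (π ⟨$⟩ʳ i ≟ i) (allFin k))

arrangements : ∀ n k → List (Arrangement n k)
arrangements n k = concatMap (λ π → List.map (π ,_) (colourings k π)) (permutations n)

≡-irrelevant : {i j : Fin n} (p q : i ≡ j) → p ≡ q
≡-irrelevant = Decidable⇒UIP.≡-irrelevant _≟_

-- Without function extensionality, permutations and arrangements have to be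
-- compared pointwise.
permutationSetoid : ℕ → Setoid 0ℓ 0ℓ
permutationSetoid n = record
  { Carrier       = Permutation′ n
  ; _≈_           = Perm._≈_
  ; isEquivalence = record
    { refl  = λ _ → ≡.refl
    ; sym   = λ e i → ≡.sym (e i)
    ; trans = λ e f i → ≡.trans (e i) (f i)
    }
  }

record _≈ᵃ_ (𝔞 𝔟 : Arrangement n k) : Set where
  constructor _,_
  field
    perm≈   : perm 𝔞 Perm.≈ perm 𝔟
    colour≈ : ∀ i p q → colour 𝔞 (i , p) ≡ colour 𝔟 (i , q)

open _≈ᵃ_

arrangementSetoid : ℕ → ℕ → Setoid 0ℓ 0ℓ
arrangementSetoid n k = record
  { Carrier       = Arrangement n k
  ; _≈_           = _≈ᵃ_
  ; isEquivalence = record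
    { refl  = λ {𝔞} → (λ _ → ≡.refl) , λ i p q → cong (λ r → colour 𝔞 (i , r)) (≡-irrelevant p q)
    ; sym   = λ e → (λ i → ≡.sym (perm≈ e i)) , λ i p q → ≡.sym (colour≈ e i q p)
    ; trans = λ e f → (λ i → ≡.trans (perm≈ e i) (perm≈ f i))
                    , λ i p q → let r = ≡.trans (≡.sym (perm≈ e i)) p in
                                ≡.trans (colour≈ e i p r) (colour≈ f i r q)
    }
  }

insert-cong : ∀ (j : Fin (suc n)) {π ρ : Permutation′ n} → π Perm.≈ ρ →
              Perm.insert zero j π Perm.≈ Perm.insert zero j ρ
insert-cong j e i with zero ≟ i
... | yes _ = ≡.refl
... | no  _ = cong (Fin.punchIn j) (e _)

insert-injective : ∀ {j l : Fin (suc n)} {π ρ : Permutation′ n} →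
                   Perm.insert zero j π Perm.≈ Perm.insert zero l ρ → j ≡ l × π Perm.≈ ρ
insert-injective {j = j} {l} {π} {ρ} e with e zero
... | ≡.refl = ≡.refl , λ i → punchIn-injective j _ _
  (≡.trans (≡.sym (Perm.insert-punchIn zero j π i))
           (≡.trans (e (suc i)) (Perm.insert-punchIn zero j ρ i)))

insert-complete : ∀ {πs} → IsEnumeration (permutationSetoid n) πs →
                  IsEnumeration (permutationSetoid (suc n))
                    (cartesianProductWith (Perm.insert zero) (allFin (suc n)) πs)
insert-complete {n} enum π =
  Anyₚ.cartesianProductWith⁺ (Perm.insert zero)
    (λ { {ρ} ≡.refl e i → ≡.trans (≡.sym (Perm.insert-remove zero π i))
                              (insert-cong (π ⟨$⟩ʳ zero) {Perm.remove zero π} e i) })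
    (∈-allFin (π ⟨$⟩ʳ zero)) (enum (Perm.remove zero π))

permutations-complete : ∀ n → IsEnumeration (permutationSetoid n) (permutations n)
permutations-complete zero    π = here λ ()
permutations-complete (suc n) = insert-complete (permutations-complete n)

permutations-unique : ∀ n → Unique (permutationSetoid n) (permutations n)
permutations-unique zero    = [] ∷ []
permutations-unique (suc n) =
  Uniqueₚ.cartesianProductWith⁺ (≡.setoid _) (permutationSetoid n) (permutationSetoid (suc n))
    (Perm.insert zero) (λ {_} {_} {π} {ρ} → insert-injective {π = π} {ρ})
    (allFin⁺ (suc n)) (permutations-unique n)

Πₛ : {I : Set} → (I → Setoid 0ℓ 0ℓ) → Setoid 0ℓ 0ℓ
Πₛ S = record
  { Carrier       = ∀ i → Setoid.Carrier (S i)
  ; _≈_           = λ f g → ∀ i → Setoid._≈_ (S i) (f i) (g i)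
  ; isEquivalence = record
    { refl  = λ i → Setoid.refl (S i)
    ; sym   = λ e i → Setoid.sym (S i) (e i)
    ; trans = λ e e′ i → Setoid.trans (S i) (e i) (e′ i)
    }
  }

ifHolds-complete : {P A : Set} (P? : Dec P) → (∀ (p q : P) → p ≡ q) →
                   {xs : List A} → IsEnumeration (≡.setoid A) xs →
                   IsEnumeration (Πₛ {P} λ _ → ≡.setoid A) (ifHolds P? xs)
ifHolds-complete (yes p) irr enum f =
  Anyₚ.map⁺ (Any.map (λ e q → ≡.trans (cong f (irr q p)) e) (enum (f p)))
ifHolds-complete (no ¬p) irr enum f = here λ p → contradiction p ¬p

ifHolds-unique : {P A : Set} (P? : Dec P) {xs : List A} → Unique (≡.setoid A) xs →
                 Unique (Πₛ {P} λ _ → ≡.setoid A) (ifHolds P? xs)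
ifHolds-unique {P} {A} (yes p) = Uniqueₚ.map⁺ (≡.setoid A) (Πₛ {P} λ _ → ≡.setoid A) (λ e → e p)
ifHolds-unique         (no _)  = λ _ → [] ∷ []

choices-complete : (S : Fin n → Setoid 0ℓ 0ℓ) (xss : ∀ i → List (Setoid.Carrier (S i))) →
                   (∀ i → IsEnumeration (S i) (xss i)) → IsEnumeration (Πₛ S) (choices xss)
choices-complete {zero}  S xss enum f = here λ ()
choices-complete {suc n} S xss enum f =
  Anyₚ.cartesianProductWith⁺ ∀-cons ∀-cons
    (enum zero (f zero)) (choices-complete (S ∘ suc) (xss ∘ suc) (enum ∘ suc) (f ∘ suc))

choices-unique : (S : Fin n → Setoid 0ℓ 0ℓ) (xss : ∀ i → List (Setoid.Carrier (S i))) →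
                 (∀ i → Unique (S i) (xss i)) → Unique (Πₛ S) (choices xss)
choices-unique {zero}  S xss uniq = [] ∷ []
choices-unique {suc n} S xss uniq =
  Uniqueₚ.cartesianProductWith⁺ (S zero) (Πₛ (S ∘ suc)) (Πₛ S) ∀-cons
    (λ e → e zero , e ∘ suc) (uniq zero) (choices-unique (S ∘ suc) (xss ∘ suc) (uniq ∘ suc))

curriedSetoid : ∀ k (π : Permutation′ n) → Fin n → Setoid 0ℓ 0ℓ
curriedSetoid k π i = Πₛ {π ⟨$⟩ʳ i ≡ i} λ _ → ≡.setoid (Fin k)

colourings-complete : ∀ k (π : Permutation′ n) → IsEnumeration (Fix π ≡.→-setoid Fin k) (colourings k π)
colourings-complete k π f = Anyₚ.map⁺ (Any.map (λ e (i , p) → e i p)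
  (choices-complete (curriedSetoid k π) _
    (λ i → ifHolds-complete (π ⟨$⟩ʳ i ≟ i) ≡-irrelevant ∈-allFin) λ i p → f (i , p)))

colourings-unique : ∀ k (π : Permutation′ n) → Unique (Fix π ≡.→-setoid Fin k) (colourings k π)
colourings-unique k π =
  Uniqueₚ.map⁺ (Πₛ (curriedSetoid k π)) (Fix π ≡.→-setoid Fin k) (λ e i p → e (i , p))
    (choices-unique (curriedSetoid k π) _ λ i → ifHolds-unique (π ⟨$⟩ʳ i ≟ i) (allFin⁺ k))

arrangements-complete : ∀ n k → IsEnumeration (arrangementSetoid n k) (arrangements n k)
arrangements-complete n k (π , φ) =
  Anyₚ.concatMap⁺ _ (Any.map complete (permutations-complete n π))
  where
  complete : ∀ {ρ} → π Perm.≈ ρ → Any ((π , φ) ≈ᵃ_) (List.map (ρ ,_) (colourings k ρ))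
  complete {ρ} e = Anyₚ.map⁺ (Any.map
    (λ {ψ} h → e , λ i p q → ≡.trans (cong (λ r → φ (i , r)) (≡-irrelevant p _)) (h (i , q)))
    (colourings-complete k ρ λ (i , q) → φ (i , ≡.trans (e i) q)))

arrangements-unique : ∀ n k → Unique (arrangementSetoid n k) (arrangements n k)
arrangements-unique n k = Uniqueₚ.concat⁺ 𝔸
  (Allₚ.map⁺ (All.universal (λ π → Uniqueₚ.map⁺ (Fix π ≡.→-setoid Fin k) 𝔸
    (λ e (i , p) → colour≈ e i p p) (colourings-unique k π)) (permutations n)))
  (AllPairsₚ.map⁺ (AllPairs.map (λ {π} {ρ} π≉ρ {𝔞} → disjoint {π} {ρ} π≉ρ {𝔞}) (permutations-unique n)))
  where
  𝔸 = arrangementSetoid n k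

  perm-∈ : ∀ {π 𝔞} (φs : List (Fix π → Fin k)) → Any (𝔞 ≈ᵃ_) (List.map (π ,_) φs) → perm 𝔞 Perm.≈ π
  perm-∈ φs 𝔞∈ = perm≈ (proj₂ (Any.satisfied (Anyₚ.map⁻ {xs = φs} 𝔞∈)))

  disjoint : ∀ {π ρ} → ¬ (π Perm.≈ ρ) →
             Disjoint 𝔸 (List.map (π ,_) (colourings k π)) (List.map (ρ ,_) (colourings k ρ))
  disjoint {π} {ρ} π≉ρ {𝔞} (∈π , ∈ρ) = π≉ρ λ i →
    ≡.trans (≡.sym (perm-∈ {π} {𝔞} (colourings k π) ∈π i)) (perm-∈ {ρ} {𝔞} (colourings k ρ) ∈ρ i)

module PowerSeries {c ℓ} (R : CommutativeRing c ℓ) where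
  open CommutativeRing R hiding (zero)
  open import Algebra.Definitions.RawSemiring (Semiring.rawSemiring semiring) public using (_^_; product)
  open import Algebra.Properties.Semiring.Sum semiring public using (sum; sum-syntax; sum⁺-syntax)
  open import Algebra.Properties.Semiring.Sum semiring using (sum-cong-≋)
  open import Relation.Binary.Reasoning.Setoid setoid

  Series : Set c
  Series = ℕ → Carrier

  infix 4 _≋_
  _≋_ : Series → Series → Set ℓ
  F ≋ G = ∀ n → F n ≈ G n

  infixl 6 _⊖_
  infixl 7 _⊛_
  infixr 8 _·_ z·_

  𝟙 : Series
  𝟙 zero    = 1#
  𝟙 (suc _) = 0#

  _⊖_ : Series → Series → Series
  (F ⊖ G) n = F n - G n

  _·_ : Carrier → Series → Series
  (x · F) n = x * F n

  z·_ : Series → Series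
  (z· F) zero    = 0#
  (z· F) (suc n) = F n

  _⊛_ : Series → Series → Series
  (F ⊛ G) n = ∑[ i ≤ n ] (F (toℕ i) * G (n ∸ toℕ i))

  -- The coefficients of zⁿ, …, z⁰ of the reciprocal.
  reciprocalUpTo : Series → ∀ n → Vector.Vector Carrier (suc n)
  reciprocalUpTo F zero    = λ _ → 1#
  reciprocalUpTo F (suc n) =
    (- (∑[ i ≤ n ] (F (suc (toℕ i)) * reciprocalUpTo F n i))) Vector.∷ reciprocalUpTo F n

  -- A reciprocal only if the constant term is 1, see 1/-inverseʳ.
  infix 9 1/_
  1/_ : Series → Series
  (1/ F) n = reciprocalUpTo F n zero

  reciprocalUpTo-1/ : ∀ F n i → reciprocalUpTo F n i ≡ (1/ F) (n ∸ toℕ i)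
  reciprocalUpTo-1/ F zero    zero    = ≡.refl
  reciprocalUpTo-1/ F (suc n) zero    = ≡.refl
  reciprocalUpTo-1/ F (suc n) (suc i) = reciprocalUpTo-1/ F n i

  reciprocalUpTo-cong : ∀ {F G} n → (∀ m → m ℕ.≤ n → F m ≈ G m) →
                        ∀ i → reciprocalUpTo F n i ≈ reciprocalUpTo G n i
  reciprocalUpTo-cong zero    e i       = refl
  reciprocalUpTo-cong (suc n) e zero    = -‿cong (sum-cong-≋ λ i →
    *-cong (e (suc (toℕ i)) (toℕ<n i)) (reciprocalUpTo-cong n (λ m m≤n → e m (ℕₚ.m≤n⇒m≤1+n m≤n)) i))
  reciprocalUpTo-cong (suc n) e (suc i) =
    reciprocalUpTo-cong n (λ m m≤n → e m (ℕₚ.m≤n⇒m≤1+n m≤n)) i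

  1/-inverseʳ : ∀ F → F 0 ≈ 1# → F ⊛ 1/ F ≋ 𝟙
  1/-inverseʳ F F₀≈1 zero    = trans (+-identityʳ _) (trans (*-identityʳ _) F₀≈1)
  1/-inverseʳ F F₀≈1 (suc n) = begin
    F 0 * - S + ∑[ i ≤ n ] (F (suc (toℕ i)) * (1/ F) (n ∸ toℕ i))
      ≈⟨ +-cong (trans (*-congʳ F₀≈1) (*-identityˡ _))
                (sum-cong-≋ λ i → *-congˡ {F (suc (toℕ i))} (reflexive (≡.sym (reciprocalUpTo-1/ F n i)))) ⟩
    - S + S
      ≈⟨ -‿inverseˡ S ⟩
    0# ∎
    where S = ∑[ i ≤ n ] (F (suc (toℕ i)) * reciprocalUpTo F n i)

  -- β 0 is never used: the numerators are β₁, β₂, ….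
  convergent : (α β : ℕ → Carrier) → ℕ → Series
  convergent α β zero    = 1/ (𝟙 ⊖ α 0 · z· 𝟙)
  convergent α β (suc N) =
    1/ (𝟙 ⊖ α 0 · z· 𝟙 ⊖ β 1 · z· z· convergent (α ∘ suc) (β ∘ suc) N)

  -- The z-adic limit of the convergents: by convergent-converges below, the
  -- coefficient of zⁿ is the same in all convergents from the n-th on.
  continuedFraction : (α β : ℕ → Carrier) → Series
  continuedFraction α β n = convergent α β n n

  convergent-zero : ∀ α β N → convergent α β N 0 ≡ 1#
  convergent-zero α β zero    = ≡.refl
  convergent-zero α β (suc N) = ≡.refl

  convergent-stable : ∀ α β N N′ n → n ℕ.≤ N → n ℕ.≤ N′ →
                      convergent α β N n ≈ convergent α β N′ n
  convergent-stable α β N       N′       zero    _         _          =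
    reflexive (≡.trans (convergent-zero α β N) (≡.sym (convergent-zero α β N′)))
  convergent-stable α β (suc N) (suc N′) (suc n) (s≤s n≤N) (s≤s n≤N′) =
    reciprocalUpTo-cong (suc n) denominators zero
    where
    denominators : ∀ m → m ℕ.≤ suc n → _ ≈ _
    denominators zero          _         = refl
    denominators (suc zero)    _         = refl
    denominators (suc (suc m)) (s≤s m<n) = +-congˡ (-‿cong (*-congˡ
      (convergent-stable (α ∘ suc) (β ∘ suc) N N′ m
        (ℕₚ.≤-trans (ℕₚ.<⇒≤ m<n) n≤N) (ℕₚ.≤-trans (ℕₚ.<⇒≤ m<n) n≤N′))))

  convergent-converges : ∀ α β n N → n ℕ.≤ N → convergent α β N n ≈ continuedFraction α β n
  convergent-converges α β n N n≤N = convergent-stable α β N n n n≤N ℕₚ.≤-refl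

  [_]⟨_,_⟩ : ℕ → Carrier → Carrier → Carrier
  [ n ]⟨ x , y ⟩ = ∑[ i < n ] (x ^ (n ∸ 1 ∸ toℕ i) * y ^ toℕ i)

  𝒞-α : (a b f g s t u w : Carrier) → ℕ → Carrier
  𝒞-α a b f g s t u w n = u * w ^ n + s * [ n ]⟨ a , b ⟩ + t * [ n ]⟨ f , g ⟩

  𝒞-β : (c d h l p r : Carrier) → ℕ → Carrier
  𝒞-β c d h l p r n = p * r * [ n ]⟨ c , d ⟩ * [ n ]⟨ h , l ⟩

  𝒞 : (a b c d f g h l p r s t u w : Carrier) → Series
  𝒞 a b c d f g h l p r s t u w = continuedFraction (𝒞-α a b f g s t u w) (𝒞-β c d h l p r)

  colourFactor : {P : Set} → Dec P → (P → Carrier) → Carrier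
  colourFactor (yes p) x = x p
  colourFactor (no _)  _ = 1#

  col : (Fin k → Carrier) → Arrangement n k → Carrier
  col u (π , φ) = product λ i → colourFactor (π ⟨$⟩ʳ i ≟ i) λ p → u (φ (i , p))

  ∑𝔸 : ∀ n k → (Arrangement n k → Carrier) → Carrier
  ∑𝔸 n k F = foldr _+_ 0# (List.map F (arrangements n k))

-- Build σ position by position. If U is the set of values of the positions before j, then the
-- factors of the monomial that belong to position j depend only on j, U and σ(j). Suppose that m
-- values below j are still unused; then m values above or equal to j are already used. Summed
-- over all possible sets of used large values, the choice of σ(j) contributes [m+1]_{c,d} when a
-- large value of an unused j is chosen, [m]_{h,l} when a small value is given to a used j, and
-- α_m otherwise; in the first case m goes up by one, in the second it goes down by one. Summing
-- over the used large values is needed because the weight of a large value depends on which ones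
-- are used, whereas the small values only matter through their number. So the sum over all
-- permutations counts weighted Motzkin paths, whose generating function is the continued fraction.

module Submission where

open import Defs
open import Algebra.Bundles using (CommutativeMonoid; CommutativeRing)
import Algebra.Properties.CommutativeMonoid.Sum
import Algebra.Solver.CommutativeMonoid
open import Data.Bool.Base using (Bool; true; false; not; _∧_; T; if_then_else_)
open import Data.Bool.Properties using (∧-assoc; ∧-comm; ∧-identityʳ; ∧-zeroʳ)
open import Data.Fin.Base as Fin using (Fin; zero; suc; toℕ)
open import Data.Fin.Permutation as Perm using (Permutation′; _⟨$⟩ʳ_; _⟨$⟩ˡ_)
open import Data.Fin.Properties as Finₚ
  using (∀-cons; punchIn-injective; punchInᵢ≢i; toℕ-injective; toℕ<n)
open import Data.List.Base
  using (List; []; _∷_; _++_; allFin; cartesianProduct; cartesianProductWith; concatMap; filter; foldr;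
         length; map; tabulate)
open import Data.List.Properties using (map-∘)
open import Data.Nat.Base as ℕ using (ℕ; zero; suc; _∸_; _<ᵇ_)
import Data.Nat.Properties as ℕₚ
open import Data.Product using (_×_; _,_; uncurry)
open import Data.Vec.Base using (Vec; []; _∷_)
open import Function.Base using (_∘_; id)
open import Function.Definitions using (Injective)
open import Level using (_⊔_)
open import Relation.Binary.Definitions using (tri<; tri≈; tri>)
open import Relation.Binary.PropositionalEquality as ≡ using (_≡_; _≢_)
import Relation.Binary.Reasoning.Setoid
open import Relation.Nullary using (Dec; ¬_; contradiction; does; no; yes)
open import Relation.Nullary.Decidable using (dec-false; dec-true)
open import Relation.Unary using (Decidable)

open Algebra.Properties.CommutativeMonoid.Sum ℕₚ.+-0-commutativeMonoid using ()
  renaming (sum to sumℕ; sum-cong-≗ to sumℕ-cong; ∑-comm to sumℕ-comm; ∑-distrib-+ to sumℕ-+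
           ; sum-permute to sumℕ-permute; sum-replicate-zero to sumℕ-0)

-- Continued fractions and Motzkin paths

-- The monomial splits over positions because each counted pair is charged to one of its two
-- positions. Pairs of excedances, and pairs with a fixed point, go to the later position: a used
-- value belongs to an earlier position, so the used large values determine the nestings and
-- crossings. Whether `j` is already used tells whether its preimage is smaller, which separates
-- `a, b, s` from `c, d, p` and `f, g, t` from `h, l, r`. For a single set of used large values the
-- weights of the possible choices do not add up to a bracket. They do when counted backwards: a set
-- of `m + 1` used values arises from `m + 1` choices, and the weight of a choice depends only on
-- the rank of the chosen value in the new set. On the other side, a continued fraction satisfies a
-- quadratic recursion while paths ending at height 0 satisfy a linear one; first-passage
-- decomposition mediates between them.

module Motzkin {e ε} (R : CommutativeRing e ε) where
  open CommutativeRing R hiding (zero)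
  open PowerSeries R
  open import Algebra.Properties.Semiring.Sum semiring
    using (sum-cong-≋; *-distribˡ-sum; ∑-distrib-+)
  open import Algebra.Properties.Ring ring using (-‿distribˡ-*; -‿+-comm; -‿involutive; -0#≈0#)
  open import Algebra.Solver.Ring.NaturalCoefficients.Default commutativeSemiring
    using (solve; _:=_; _:+_; _:*_)
  open import Relation.Binary.Reasoning.Setoid setoid

  infixl 6 _⊕_
  _⊕_ : Series → Series → Series
  (F ⊕ G) n = F n + G n

  ⊛-cong : ∀ {F F′ G G′} → F ≋ F′ → G ≋ G′ → F ⊛ G ≋ F′ ⊛ G′
  ⊛-cong F≋F′ G≋G′ n = sum-cong-≋ {suc n} λ i → *-cong (F≋F′ (toℕ i)) (G≋G′ (n ∸ toℕ i))

  ⊕-⊛-distribʳ : ∀ F G H → (F ⊕ G) ⊛ H ≋ F ⊛ H ⊕ G ⊛ H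
  ⊕-⊛-distribʳ F G H n = trans (sum-cong-≋ {suc n} λ i → distribʳ (H (n ∸ toℕ i)) (F (toℕ i)) (G (toℕ i)))
    (∑-distrib-+ {suc n} (λ i → F (toℕ i) * H (n ∸ toℕ i)) (λ i → G (toℕ i) * H (n ∸ toℕ i)))

  ·-⊛-assoc : ∀ x F G → (x · F) ⊛ G ≋ x · (F ⊛ G)
  ·-⊛-assoc x F G n = trans (sum-cong-≋ {suc n} λ i → *-assoc x (F (toℕ i)) (G (n ∸ toℕ i)))
    (sym (*-distribˡ-sum {suc n} x (λ i → F (toℕ i) * G (n ∸ toℕ i))))

  ⊛-·-comm : ∀ x F G → F ⊛ (x · G) ≋ x · (F ⊛ G)
  ⊛-·-comm x F G n = trans
    (sum-cong-≋ {suc n} λ i → solve 3 (λ x f g → f :* (x :* g) := x :* (f :* g)) refl x (F (toℕ i)) (G (n ∸ toℕ i)))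
    (sym (*-distribˡ-sum {suc n} x (λ i → F (toℕ i) * G (n ∸ toℕ i))))

  z·-⊛-assoc : ∀ F G → (z· F) ⊛ G ≋ z· (F ⊛ G)
  z·-⊛-assoc F G zero    = trans (+-identityʳ _) (zeroˡ _)
  z·-⊛-assoc F G (suc n) = trans (+-congʳ (zeroˡ _)) (+-identityˡ _)

  ⊛-z·-comm : ∀ F G → F ⊛ (z· G) ≋ z· (F ⊛ G)
  ⊛-z·-comm F G zero          = trans (+-identityʳ _) (zeroʳ _)
  ⊛-z·-comm F G (suc zero)    = +-congˡ (trans (+-identityʳ _) (zeroʳ _))
  ⊛-z·-comm F G (suc (suc n)) = +-congˡ (⊛-z·-comm (F ∘ suc) G (suc n))

  ⊛-assoc : ∀ F G H → (F ⊛ G) ⊛ H ≋ F ⊛ (G ⊛ H)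
  ⊛-assoc F G H zero    = +-congʳ (begin
    (F 0 * G 0 + 0#) * H 0 ≈⟨ *-congʳ (+-identityʳ _) ⟩
    F 0 * G 0 * H 0        ≈⟨ *-assoc _ _ _ ⟩
    F 0 * (G 0 * H 0)      ≈⟨ *-congˡ (+-identityʳ _) ⟨
    F 0 * (G 0 * H 0 + 0#) ∎)
  ⊛-assoc F G H (suc n) = begin
    (F 0 * G 0 + 0#) * H (suc n) + ((F ⊛ G) ∘ suc ⊛ H) n
      ≈⟨ +-cong (*-congʳ (+-identityʳ _))
                (trans (⊕-⊛-distribʳ (F 0 · (G ∘ suc)) (F ∘ suc ⊛ G) H n)
                       (+-cong (·-⊛-assoc (F 0) (G ∘ suc) H n) (⊛-assoc (F ∘ suc) G H n))) ⟩
    F 0 * G 0 * H (suc n) + (F 0 * (G ∘ suc ⊛ H) n + (F ∘ suc ⊛ (G ⊛ H)) n)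
      ≈⟨ solve 5 (λ f g h x y → f :* g :* h :+ (f :* x :+ y) := f :* (g :* h :+ x) :+ y)
           refl (F 0) (G 0) (H (suc n)) ((G ∘ suc ⊛ H) n) ((F ∘ suc ⊛ (G ⊛ H)) n) ⟩
    F 0 * (G 0 * H (suc n) + (G ∘ suc ⊛ H) n) + (F ∘ suc ⊛ (G ⊛ H)) n ∎

  z·-cong : ∀ {F G} → F ≋ G → z· F ≋ z· G
  z·-cong F≋G zero    = refl
  z·-cong F≋G (suc n) = F≋G n

  z·-· : ∀ x F → z· x · F ≋ x · z· F
  z·-· x F zero    = sym (zeroʳ x)
  z·-· x F (suc n) = refl

  -- Coefficientwise form of `F = 1 + α₀ z F + β₁ z² F′ F`. It is the recursion of the reciprocal
  -- itself, once the convergents are replaced by their limits, which agree with them in all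
  -- coefficients involved.
  continuedFraction-suc : ∀ α β → let F = continuedFraction α β; F′ = continuedFraction (α ∘ suc) (β ∘ suc) in
                          F ∘ suc ≋ α 0 · F ⊕ β 1 · z· (F′ ⊛ F)
  continuedFraction-suc α β n = begin
    - (D 1 * reciprocalUpTo D n zero + ∑[ i < n ] (D (suc (suc (toℕ i))) * reciprocalUpTo D n (suc i)))
      ≈⟨ -‿cong (+-cong (*-cong D₁ (coefficient zero)) (tail n coefficient D₂)) ⟩
    - (- α 0 * F n + - (β 1 * (z· (F′ ⊛ F)) n))
      ≈⟨ -‿+-comm _ _ ⟨
    - (- α 0 * F n) + - - (β 1 * (z· (F′ ⊛ F)) n)
      ≈⟨ +-cong (trans (-‿distribˡ-* _ _) (*-congʳ (-‿involutive _))) (-‿involutive _) ⟩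
    α 0 * F n + β 1 * (z· (F′ ⊛ F)) n ∎
    where
    F  = continuedFraction α β
    F′ = continuedFraction (α ∘ suc) (β ∘ suc)
    D  = 𝟙 ⊖ α 0 · z· 𝟙 ⊖ β 1 · z· z· convergent (α ∘ suc) (β ∘ suc) n

    0-0≈0 : 0# - 0# ≈ 0#
    0-0≈0 = -‿inverseʳ 0#

    D₁ : D 1 ≈ - α 0
    D₁ = begin
      0# - α 0 * 1# - β 1 * 0# ≈⟨ +-cong (+-congˡ (-‿cong (*-identityʳ _))) (trans (-‿cong (zeroʳ _)) -0#≈0#) ⟩
      0# - α 0 + 0#            ≈⟨ trans (+-identityʳ _) (+-identityˡ _) ⟩
      - α 0                    ∎

    coefficient : ∀ i → reciprocalUpTo D n i ≈ F (n ∸ toℕ i)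
    coefficient i = trans (reflexive (reciprocalUpTo-1/ D n i))
      (convergent-converges α β (n ∸ toℕ i) (suc n) (ℕₚ.m≤n⇒m≤1+n (ℕₚ.m∸n≤m n (toℕ i))))

    D₂ : ∀ i → i ℕ.< n → D (suc (suc i)) ≈ - (β 1 * F′ i)
    D₂ i i<n = begin
      0# - α 0 * 0# - β 1 * convergent (α ∘ suc) (β ∘ suc) n i
        ≈⟨ +-cong (trans (+-congˡ (-‿cong (zeroʳ _))) 0-0≈0)
                  (-‿cong (*-congˡ (convergent-converges (α ∘ suc) (β ∘ suc) i n (ℕₚ.<⇒≤ i<n)))) ⟩
      0# - β 1 * F′ i ≈⟨ +-identityˡ _ ⟩
      - (β 1 * F′ i)  ∎

    tail : ∀ m → (∀ i → reciprocalUpTo D m i ≈ F (m ∸ toℕ i)) →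
           (∀ i → i ℕ.< m → D (suc (suc i)) ≈ - (β 1 * F′ i)) →
           ∑[ i < m ] (D (suc (suc (toℕ i))) * reciprocalUpTo D m (suc i)) ≈ - (β 1 * (z· (F′ ⊛ F)) m)
    tail zero    _    _   = sym (trans (-‿cong (zeroʳ _)) -0#≈0#)
    tail (suc m) rec≈ D≈ = begin
      ∑[ i ≤ m ] (D (suc (suc (toℕ i))) * reciprocalUpTo D m i)
        ≈⟨ sum-cong-≋ {suc m} (λ i → trans (*-cong (D≈ (toℕ i) (toℕ<n i)) (rec≈ (suc i)))
             (trans (sym (-‿distribˡ-* _ _)) (trans (-‿cong (*-assoc _ _ _)) (-‿distribˡ-* _ _)))) ⟩
      ∑[ i ≤ m ] (- β 1 * (F′ (toℕ i) * F (m ∸ toℕ i)))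
        ≈⟨ *-distribˡ-sum {suc m} (- β 1) (λ i → F′ (toℕ i) * F (m ∸ toℕ i)) ⟨
      - β 1 * (F′ ⊛ F) m
        ≈⟨ -‿distribˡ-* _ _ ⟨
      - (β 1 * (F′ ⊛ F) m) ∎

  -- Motzkin paths of N steps from height m down to height 0; up m and down m
  -- are the weights of the two steps between the heights m - 1 and m.
  paths : (α up down : ℕ → Carrier) → ℕ → ℕ → Carrier
  paths α up down zero    zero    = 1#
  paths α up down zero    (suc m) = 0#
  paths α up down (suc N) zero    = α 0 * paths α up down N 0 + up 1 * paths α up down N 1
  paths α up down (suc N) (suc m) =
    α (suc m) * paths α up down N (suc m)
      + up (suc (suc m)) * paths α up down N (suc (suc m))
      + down (suc m) * paths α up down N m

  -- `M m` should be thought of as the series of the paths from height `m` back to `m` that stay at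
  -- height `m` or above. `M-suc` then says that the first step is level, or goes up and the path is
  -- cut at its first return to `m`.
  module _ (α up down : ℕ → Carrier) (M : ℕ → Series)
           (M-zero : ∀ m → M m 0 ≈ 1#)
           (M-suc : ∀ m → M m ∘ suc ≋ α m · M m ⊕ (up (suc m) * down (suc m)) · z· (M (suc m) ⊛ M m))
    where

    -- First-passage decomposition of the paths from height m to height 0.
    descent : ℕ → Series
    descent zero    = M 0
    descent (suc m) = down (suc m) · z· (M (suc m) ⊛ descent m)

    -- The same cut for such a path followed by a continuation `G`, reassociated so that `M m ⊛ G`
    -- reappears on the right. This is what linearises the quadratic recursion.
    ⊛-unfold : ∀ m G → M m ⊛ G ≋ G ⊕ α m · z· (M m ⊛ G)
                                   ⊕ (up (suc m) * down (suc m)) · z· z· (M (suc m) ⊛ (M m ⊛ G))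
    ⊛-unfold m G zero    = begin
      M m 0 * G 0 + 0#             ≈⟨ +-cong (trans (*-congʳ (M-zero m)) (*-identityˡ _)) (sym (zeroʳ _)) ⟩
      G 0 + _ * 0#                 ≈⟨ +-congʳ (trans (+-congˡ (zeroʳ _)) (+-identityʳ _)) ⟨
      G 0 + α m * 0# + _ * 0#      ∎
    ⊛-unfold m G (suc n) = begin
      M m 0 * G (suc n) + (M m ∘ suc ⊛ G) n
        ≈⟨ +-cong (trans (*-congʳ (M-zero m)) (*-identityˡ _)) (begin
             (M m ∘ suc ⊛ G) n
               ≈⟨ ⊛-cong {G = G} (M-suc m) (λ _ → refl) n ⟩
             ((α m · M m ⊕ β · z· (M (suc m) ⊛ M m)) ⊛ G) n
               ≈⟨ ⊕-⊛-distribʳ (α m · M m) (β · z· (M (suc m) ⊛ M m)) G n ⟩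
             ((α m · M m) ⊛ G) n + ((β · z· (M (suc m) ⊛ M m)) ⊛ G) n
               ≈⟨ +-cong (·-⊛-assoc _ (M m) G n) (trans (·-⊛-assoc β (z· (M (suc m) ⊛ M m)) G n)
                    (*-congˡ (trans (z·-⊛-assoc (M (suc m) ⊛ M m) G n) (z·-cong (⊛-assoc (M (suc m)) (M m) G) n)))) ⟩
             α m * (M m ⊛ G) n + β * (z· (M (suc m) ⊛ (M m ⊛ G))) n ∎) ⟩
      G (suc n) + (α m * (M m ⊛ G) n + β * (z· (M (suc m) ⊛ (M m ⊛ G))) n)
        ≈⟨ +-assoc _ _ _ ⟨
      G (suc n) + α m * (M m ⊛ G) n + β * (z· (M (suc m) ⊛ (M m ⊛ G))) n ∎
      where
      β = up (suc m) * down (suc m)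

    -- Both sides obey the same recursion in the number of steps. If the part before the first
    -- descent from `suc m` is empty, the path steps down; otherwise that part begins with a level
    -- step or an up step.
    descent-paths : ∀ N m → descent m N ≈ paths α up down N m
    descent-paths zero    zero    = M-zero 0
    descent-paths zero    (suc m) = zeroʳ _
    descent-paths (suc N) zero    = begin
      M 0 (suc N)
        ≈⟨ M-suc 0 N ⟩
      α 0 * M 0 N + up 1 * down 1 * (z· (M 1 ⊛ M 0)) N
        ≈⟨ +-congˡ (*-assoc _ _ _) ⟩
      α 0 * descent 0 N + up 1 * descent 1 N
        ≈⟨ +-cong (*-congˡ (descent-paths N 0)) (*-congˡ (descent-paths N 1)) ⟩
      paths α up down (suc N) 0 ∎
    descent-paths (suc N) (suc m) = begin
      x * (M (suc m) ⊛ descent m) N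
        ≈⟨ *-congˡ (⊛-unfold (suc m) (descent m) N) ⟩
      x * (descent m N + α (suc m) * Q + y * x′ * S)
        ≈⟨ solve 7 (λ x k a q y x′ s →
             x :* (k :+ a :* q :+ y :* x′ :* s) := a :* (x :* q) :+ y :* (x′ :* (x :* s)) :+ x :* k)
             refl x (descent m N) (α (suc m)) Q y x′ S ⟩
      α (suc m) * descent (suc m) N + y * (x′ * (x * S)) + x * descent m N
        -- The weight of the later step down from `suc m` moves inside the product, where it
        -- completes `descent (suc m)`.
        ≈⟨ +-congʳ (+-congˡ (*-congˡ (*-congˡ S-shift))) ⟩
      α (suc m) * descent (suc m) N + y * descent (suc (suc m)) N + x * descent m N
        ≈⟨ +-cong (+-cong (*-congˡ (descent-paths N (suc m))) (*-congˡ (descent-paths N (suc (suc m)))))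
                  (*-congˡ (descent-paths N m)) ⟩
      paths α up down (suc N) (suc m) ∎
      where
      x  = down (suc m)
      x′ = down (suc (suc m))
      y  = up (suc (suc m))
      P  = M (suc m) ⊛ descent m
      Q  = (z· P) N
      S  = (z· z· (M (suc (suc m)) ⊛ P)) N

      S-shift : x * S ≈ (z· (M (suc (suc m)) ⊛ descent (suc m))) N
      S-shift = sym (begin
        (z· (M (suc (suc m)) ⊛ (x · z· P))) N ≈⟨ z·-cong (⊛-·-comm x (M (suc (suc m))) (z· P)) N ⟩
        (z· x · (M (suc (suc m)) ⊛ z· P)) N   ≈⟨ z·-· x _ N ⟩
        x * (z· (M (suc (suc m)) ⊛ z· P)) N   ≈⟨ *-congˡ (z·-cong (⊛-z·-comm (M (suc (suc m))) P) N) ⟩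
        x * S                                 ∎)

  -- Recursive, so that `shift (suc m) α` is by definition the tail `shift m α ∘ suc` that occurs in
  -- `continuedFraction-suc`.
  shift : ∀ {A : Set e} → ℕ → (ℕ → A) → ℕ → A
  shift zero    α = α
  shift (suc m) α = shift m α ∘ suc

  shift-+ : ∀ {A : Set e} m (α : ℕ → A) k → shift m α k ≡ α (m ℕ.+ k)
  shift-+ zero    α k = ≡.refl
  shift-+ (suc m) α k = ≡.trans (shift-+ m α (suc k)) (≡.cong α (ℕₚ.+-suc m k))

  -- On a path from height 0 to height 0 the up and down steps between two given heights are equally
  -- many, so any factorisation of `β m` into step weights gives the same series.
  continuedFraction-paths : ∀ α up down β → (∀ m → β m ≈ up m * down m) →
                            continuedFraction α β ≋ λ n → paths α up down n 0
  continuedFraction-paths α up down β β≈ n =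
    descent-paths α up down M (λ m → reflexive (convergent-zero (shift m α) (shift m β) 0)) M-suc n 0
    where
    M : ℕ → Series
    M m = continuedFraction (shift m α) (shift m β)

    M-suc : ∀ m → M m ∘ suc ≋ α m · M m ⊕ (up (suc m) * down (suc m)) · z· (M (suc m) ⊛ M m)
    M-suc m n = trans (continuedFraction-suc (shift m α) (shift m β) n)
      (+-cong (*-congʳ (reflexive (≡.trans (shift-+ m α 0) (≡.cong α (ℕₚ.+-identityʳ m)))))
              (*-congʳ (trans (reflexive (≡.trans (shift-+ m β 1) (≡.cong β (ℕₚ.+-comm m 1)))) (β≈ (suc m)))))

-- Counting over ranges of natural numbers and over lists

module RangeSum {e ℓ} (M : CommutativeMonoid e ℓ) where
  open CommutativeMonoid M
  open import Algebra.Properties.CommutativeMonoid.Sum M using (sum; sum-cong-≋)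

  prefix : ℕ → (ℕ → Carrier) → Carrier
  prefix zero    F = ε
  prefix (suc j) F = prefix j F ∙ F j

  -- The second argument is the length: range q N F is the sum of F over [q, q + N).
  range : ℕ → ℕ → (ℕ → Carrier) → Carrier
  range q zero    F = ε
  range q (suc N) F = F q ∙ range (suc q) N F

  prefix-cong : ∀ j {F G} → (∀ v → v ℕ.< j → F v ≈ G v) → prefix j F ≈ prefix j G
  prefix-cong zero    F≈G = refl
  prefix-cong (suc j) F≈G =
    ∙-cong (prefix-cong j λ v v<j → F≈G v (ℕₚ.m<n⇒m<1+n v<j)) (F≈G j ℕₚ.≤-refl)

  range-cong : ∀ q N {F G} → (∀ v → q ℕ.≤ v → F v ≈ G v) → range q N F ≈ range q N G
  range-cong q zero    F≈G = refl
  range-cong q (suc N) F≈G = ∙-cong (F≈G q ℕₚ.≤-refl) (range-cong (suc q) N λ v q<v → F≈G v (ℕₚ.<⇒≤ q<v))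

  range-ε : ∀ q N → range q N (λ _ → ε) ≈ ε
  range-ε q zero    = refl
  range-ε q (suc N) = trans (identityˡ _) (range-ε (suc q) N)

  prefix-ε : ∀ j → prefix j (λ _ → ε) ≈ ε
  prefix-ε zero    = refl
  prefix-ε (suc j) = trans (identityʳ _) (prefix-ε j)

  prefix-range : ∀ j N F → range 0 (j ℕ.+ N) F ≈ prefix j F ∙ range j N F
  prefix-range zero    N F = sym (identityˡ _)
  prefix-range (suc j) N F = trans
    (trans (reflexive (≡.cong (λ k → range 0 k F) (≡.sym (ℕₚ.+-suc j N)))) (prefix-range j (suc N) F))
    (sym (assoc _ _ _))

  sumᴸ : ∀ {A : Set} → List A → (A → Carrier) → Carrier
  sumᴸ xs F = foldr _∙_ ε (map F xs)

  sumᴸ-cong : ∀ {A : Set} (xs : List A) {F G : A → Carrier} → (∀ x → F x ≈ G x) → sumᴸ xs F ≈ sumᴸ xs G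
  sumᴸ-cong []       F≈G = refl
  sumᴸ-cong (x ∷ xs) F≈G = ∙-cong (F≈G x) (sumᴸ-cong xs F≈G)

  sumᴸ-++ : ∀ {A : Set} (xs ys : List A) F → sumᴸ (xs ++ ys) F ≈ sumᴸ xs F ∙ sumᴸ ys F
  sumᴸ-++ []       ys F = sym (identityˡ _)
  sumᴸ-++ (x ∷ xs) ys F = trans (∙-congˡ (sumᴸ-++ xs ys F)) (sym (assoc _ _ _))

  sumᴸ-map : ∀ {A B : Set} (f : A → B) xs F → sumᴸ (map f xs) F ≡ sumᴸ xs (F ∘ f)
  sumᴸ-map f xs F = ≡.cong (foldr _∙_ ε) (≡.sym (map-∘ xs))

  sumᴸ-concatMap : ∀ {A B : Set} (f : A → List B) xs F → sumᴸ (concatMap f xs) F ≈ sumᴸ xs (λ x → sumᴸ (f x) F)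
  sumᴸ-concatMap f []       F = refl
  sumᴸ-concatMap f (x ∷ xs) F = trans (sumᴸ-++ (f x) _ F) (∙-congˡ (sumᴸ-concatMap f xs F))

  sumᴸ-cartesianProductWith : ∀ {A B C : Set} (f : A → B → C) xs ys F →
                              sumᴸ (cartesianProductWith f xs ys) F ≈ sumᴸ xs (λ x → sumᴸ ys (F ∘ f x))
  sumᴸ-cartesianProductWith f []       ys F = refl
  sumᴸ-cartesianProductWith f (x ∷ xs) ys F = trans (sumᴸ-++ (map (f x) ys) _ F)
    (∙-cong (reflexive (sumᴸ-map (f x) ys F)) (sumᴸ-cartesianProductWith f xs ys F))

  sumᴸ-tabulate : ∀ {A : Set} {n} (f : Fin n → A) F → sumᴸ (tabulate f) F ≡ sum (F ∘ f)
  sumᴸ-tabulate {n = zero}  f F = ≡.refl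
  sumᴸ-tabulate {n = suc n} f F = ≡.cong (F (f zero) ∙_) (sumᴸ-tabulate (f ∘ suc) F)

  sum-range : ∀ q N F → sum {N} (λ i → F (q ℕ.+ toℕ i)) ≈ range q N F
  sum-range q zero    F = refl
  sum-range q (suc N) F = ∙-cong (reflexive (≡.cong F (ℕₚ.+-identityʳ q)))
    (trans (sum-cong-≋ {N} λ i → reflexive (≡.cong F (ℕₚ.+-suc q (toℕ i)))) (sum-range (suc q) N F))

open RangeSum ℕₚ.+-0-commutativeMonoid using ()
  renaming ( prefix to prefixℕ; range to rangeℕ; prefix-cong to prefixℕ-cong; range-cong to rangeℕ-cong
           ; sumᴸ to sumᴸℕ; sumᴸ-cartesianProductWith to sumᴸℕ-cartesianProductWith; sumᴸ-tabulate to sumᴸℕ-tabulate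
           ; prefix-ε to prefixℕ-0; range-ε to rangeℕ-0; prefix-range to prefixℕ-rangeℕ; sum-range to sum-rangeℕ)

⟦_⟧ : Bool → ℕ
⟦ true ⟧  = 1
⟦ false ⟧ = 0

#prefix : ℕ → (ℕ → Bool) → ℕ
#prefix j P = prefixℕ j (⟦_⟧ ∘ P)

#range : ℕ → ℕ → (ℕ → Bool) → ℕ
#range q N P = rangeℕ q N (⟦_⟧ ∘ P)

<ᵇ-true : ∀ {m n} → m ℕ.< n → (m <ᵇ n) ≡ true
<ᵇ-true {m} {n} = dec-true (m ℕₚ.<? n)

<ᵇ-false : ∀ {m n} → n ℕ.≤ m → (m <ᵇ n) ≡ false
<ᵇ-false {m} {n} n≤m = dec-false (m ℕₚ.<? n) (ℕₚ.≤⇒≯ n≤m)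

#prefix-cong : ∀ j {P Q} → (∀ v → v ℕ.< j → P v ≡ Q v) → #prefix j P ≡ #prefix j Q
#prefix-cong j P≡Q = prefixℕ-cong j λ v v<j → ≡.cong ⟦_⟧ (P≡Q v v<j)

#range-cong : ∀ q N {P Q} → (∀ v → q ℕ.≤ v → P v ≡ Q v) → #range q N P ≡ #range q N Q
#range-cong q N P≡Q = rangeℕ-cong q N λ v q≤v → ≡.cong ⟦_⟧ (P≡Q v q≤v)

#prefix-false : ∀ j {P} → (∀ v → v ℕ.< j → P v ≡ false) → #prefix j P ≡ 0
#prefix-false j P≡f = ≡.trans (#prefix-cong j P≡f) (prefixℕ-0 j)

#range-false : ∀ q N {P} → (∀ v → q ℕ.≤ v → P v ≡ false) → #range q N P ≡ 0
#range-false q N P≡f = ≡.trans (#range-cong q N P≡f) (rangeℕ-0 q N)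

-- Sets of used values

add : ℕ → (ℕ → Bool) → ℕ → Bool
add v U v′ = if does (v ℕₚ.≟ v′) then true else U v′

add-≡ : ∀ v U → add v U v ≡ true
add-≡ v U rewrite dec-true (v ℕₚ.≟ v) ≡.refl = ≡.refl

add-≢ : ∀ {v v′} U → v ≢ v′ → add v U v′ ≡ U v′
add-≢ {v} {v′} U v≢v′ rewrite dec-false (v ℕₚ.≟ v′) v≢v′ = ≡.refl

flags : (ℕ → Bool) → ℕ → ∀ N → Vec Bool N
flags U q zero    = []
flags U q (suc N) = U q ∷ flags U (suc q) N

flags-add-< : ∀ {v q} U N → v ℕ.< q → flags (add v U) q N ≡ flags U q N
flags-add-< U zero    v<q = ≡.refl
flags-add-< U (suc N) v<q =
  ≡.cong₂ _∷_ (add-≢ U (ℕₚ.<⇒≢ v<q)) (flags-add-< U N (ℕₚ.m<n⇒m<1+n v<q))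

#true : ∀ {N} → Vec Bool N → ℕ
#true []      = 0
#true (b ∷ x) = ⟦ b ⟧ ℕ.+ #true x

#true-flags : ∀ U q N → #true (flags U q N) ≡ #range q N U
#true-flags U q zero    = ≡.refl
#true-flags U q (suc N) = ≡.cong (⟦ U q ⟧ ℕ.+_) (#true-flags U (suc q) N)

unused : (ℕ → Bool) → ℕ → ℕ
unused U j = #prefix j (not ∘ U)

unused-add-≥ : ∀ {v} U j → j ℕ.≤ v → unused (add v U) j ≡ unused U j
unused-add-≥ U j j≤v = #prefix-cong j λ v′ v′<j →
  ≡.cong not (add-≢ U (≡.≢-sym (ℕₚ.<⇒≢ (ℕₚ.<-≤-trans v′<j j≤v))))

unused-add-< : ∀ {v} U j → v ℕ.< j → U v ≡ false → suc (unused (add v U) j) ≡ unused U j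
unused-add-< {v} U (suc j) v<1+j Uv with v ℕₚ.≟ j
... | yes ≡.refl rewrite unused-add-≥ {v} U v ℕₚ.≤-refl | add-≡ v U | Uv = ≡.trans (≡.cong suc (ℕₚ.+-identityʳ _)) (ℕₚ.+-comm 1 _)
... | no v≢j rewrite add-≢ U v≢j = ≡.cong (ℕ._+ ⟦ not (U j) ⟧) (unused-add-< U j (ℕₚ.≤∧≢⇒< (ℕ.s≤s⁻¹ v<1+j) v≢j) Uv)

-- Brackets as sums over the choice of a value

module Transfer {e ε} (R : CommutativeRing e ε) where
  open CommutativeRing R hiding (zero)
  open PowerSeries R
  open RangeSum +-commutativeMonoid
  open import Algebra.Properties.Semiring.Sum semiring using (sum-cong-≋; *-distribˡ-sum)
  open import Algebra.Properties.Semiring.Exp semiring using (^-homo-*)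
  open import Algebra.Solver.Ring.NaturalCoefficients.Default commutativeSemiring
    using (solve; _:=_; _:+_; _:*_)
  open import Relation.Binary.Reasoning.Setoid setoid

  [suc] : ∀ m x y → [ suc m ]⟨ x , y ⟩ ≈ x ^ m + y * [ m ]⟨ x , y ⟩
  [suc] m x y = +-cong (*-identityʳ _) (begin
    ∑[ i < m ] (x ^ (m ∸ suc (toℕ i)) * (y * y ^ toℕ i))
      ≈⟨ sum-cong-≋ {m} (λ i → trans
           (*-congʳ (reflexive (≡.cong (x ^_) (≡.sym (ℕₚ.∸-+-assoc m 1 (toℕ i))))))
           (solve 3 (λ p q y → p :* (y :* q) := y :* (p :* q)) refl (x ^ (m ∸ 1 ∸ toℕ i)) (y ^ toℕ i) y)) ⟩
    ∑[ i < m ] (y * (x ^ (m ∸ 1 ∸ toℕ i) * y ^ toℕ i))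
      ≈⟨ *-distribˡ-sum {m} y (λ i → x ^ (m ∸ 1 ∸ toℕ i) * y ^ toℕ i) ⟨
    y * [ m ]⟨ x , y ⟩ ∎)

  -- The sum over all flag vectors with exactly m flags set.
  layer : ℕ → ∀ {N} → (Vec Bool N → Carrier) → Carrier
  layer zero    {zero}  Ψ = Ψ []
  layer (suc m) {zero}  Ψ = 0#
  layer zero    {suc N} Ψ = layer zero (Ψ ∘ (false ∷_))
  layer (suc m) {suc N} Ψ = layer (suc m) (Ψ ∘ (false ∷_)) + layer m (Ψ ∘ (true ∷_))

  layer-cong : ∀ m {N} {Ψ Φ : Vec Bool N → Carrier} → (∀ x → #true x ≡ m → Ψ x ≈ Φ x) → layer m Ψ ≈ layer m Φ
  layer-cong zero    {zero}  Ψ≈Φ = Ψ≈Φ [] ≡.refl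
  layer-cong (suc m) {zero}  Ψ≈Φ = refl
  layer-cong zero    {suc N} Ψ≈Φ = layer-cong zero λ x → Ψ≈Φ (false ∷ x)
  layer-cong (suc m) {suc N} Ψ≈Φ =
    +-cong (layer-cong (suc m) λ x → Ψ≈Φ (false ∷ x)) (layer-cong m λ x eq → Ψ≈Φ (true ∷ x) (≡.cong suc eq))

  layer-+ : ∀ m {N} (Ψ Φ : Vec Bool N → Carrier) → layer m (λ x → Ψ x + Φ x) ≈ layer m Ψ + layer m Φ
  layer-+ zero    {zero}  Ψ Φ = refl
  layer-+ (suc m) {zero}  Ψ Φ = sym (+-identityʳ _)
  layer-+ zero    {suc N} Ψ Φ = layer-+ zero {N} _ _
  layer-+ (suc m) {suc N} Ψ Φ = trans (+-cong (layer-+ (suc m) {N} _ _) (layer-+ m {N} _ _))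
    (solve 4 (λ p q p′ q′ → (p :+ q) :+ (p′ :+ q′) := (p :+ p′) :+ (q :+ q′)) refl
      (layer (suc m) (Ψ ∘ (false ∷_))) (layer (suc m) (Φ ∘ (false ∷_))) (layer m (Ψ ∘ (true ∷_))) (layer m (Φ ∘ (true ∷_))))

  layer-* : ∀ m k {N} (Ψ : Vec Bool N → Carrier) → layer m (λ x → k * Ψ x) ≈ k * layer m Ψ
  layer-* zero    k {zero}  Ψ = refl
  layer-* (suc m) k {zero}  Ψ = sym (zeroʳ k)
  layer-* zero    k {suc N} Ψ = layer-* zero k {N} _
  layer-* (suc m) k {suc N} Ψ = trans (+-cong (layer-* (suc m) k {N} _) (layer-* m k {N} _)) (sym (distribˡ k _ _))

  layer-^ : ∀ x m {N} (Ψ : Vec Bool N → Carrier) → layer m (λ v → x ^ #true v * Ψ v) ≈ x ^ m * layer m Ψ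
  layer-^ x m {N} Ψ =
    trans (layer-cong m {N} λ v eq → *-congʳ (reflexive (≡.cong (x ^_) eq))) (layer-* m (x ^ m) {N} Ψ)

  layer-zero : ∀ q N (Ψ : Vec Bool N → Carrier) → layer 0 Ψ ≈ Ψ (flags (λ _ → false) q N)
  layer-zero q zero    Ψ = refl
  layer-zero q (suc N) Ψ = layer-zero (suc q) N (Ψ ∘ (false ∷_))

  -- Sets one of the unset flags, weighted by x for every set flag after it and
  -- by y for every set flag before it.
  pick : Carrier → Carrier → ∀ {N} → Vec Bool N → (Vec Bool N → Carrier) → Carrier
  pick x y []          Ψ = 0#
  pick x y (false ∷ v) Ψ = x ^ #true v * Ψ (true ∷ v) + pick x y v (Ψ ∘ (false ∷_))
  pick x y (true  ∷ v) Ψ = y * pick x y v (Ψ ∘ (true ∷_))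

  -- Double counting: a vector with `suc m` set flags is reached once for each of them. If the
  -- picked flag has `i` set flags before it, then `m - i` come after it, and the weights
  -- `x ^ (m - i) * y ^ i` add up to the bracket, whatever the vector.
  layer-pick : ∀ x y m {N} (Ψ : Vec Bool N → Carrier) →
               layer m (λ v → pick x y v Ψ) ≈ [ suc m ]⟨ x , y ⟩ * layer (suc m) Ψ
  layer-pick x y zero    {zero}  Ψ = sym (zeroʳ _)
  layer-pick x y (suc m) {zero}  Ψ = sym (zeroʳ _)
  layer-pick x y zero    {suc N} Ψ = begin
    layer 0 (λ v → x ^ #true v * Ψ (true ∷ v) + pick x y v (Ψ ∘ (false ∷_)))
      ≈⟨ layer-+ 0 {N} _ _ ⟩
    layer 0 (λ v → x ^ #true v * Ψ (true ∷ v)) + layer 0 (λ v → pick x y v (Ψ ∘ (false ∷_)))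
      ≈⟨ +-cong (layer-^ x 0 (Ψ ∘ (true ∷_)))
                (layer-pick x y 0 (Ψ ∘ (false ∷_))) ⟩
    1# * layer 0 (Ψ ∘ (true ∷_)) + [ 1 ]⟨ x , y ⟩ * layer 1 (Ψ ∘ (false ∷_))
      ≈⟨ +-comm _ _ ⟩
    [ 1 ]⟨ x , y ⟩ * layer 1 (Ψ ∘ (false ∷_)) + 1# * layer 0 (Ψ ∘ (true ∷_))
      ≈⟨ +-congˡ (*-congʳ (trans ([suc] 0 x y) (trans (+-congˡ (zeroʳ y)) (+-identityʳ 1#)))) ⟨
    [ 1 ]⟨ x , y ⟩ * layer 1 (Ψ ∘ (false ∷_)) + [ 1 ]⟨ x , y ⟩ * layer 0 (Ψ ∘ (true ∷_))
      ≈⟨ distribˡ _ _ _ ⟨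
    [ 1 ]⟨ x , y ⟩ * layer 1 Ψ ∎
  layer-pick x y (suc m) {suc N} Ψ = begin
    layer (suc m) (λ v → x ^ #true v * Ψ (true ∷ v) + pick x y v (Ψ ∘ (false ∷_)))
      + layer m (λ v → y * pick x y v (Ψ ∘ (true ∷_)))
      ≈⟨ +-cong (trans (layer-+ (suc m) {N} _ _) (+-cong
           (layer-^ x (suc m) (Ψ ∘ (true ∷_)))
           (layer-pick x y (suc m) (Ψ ∘ (false ∷_)))))
           (trans (layer-* m y {N} _) (*-congˡ (layer-pick x y m (Ψ ∘ (true ∷_))))) ⟩
    x ^ suc m * B + [ suc (suc m) ]⟨ x , y ⟩ * A + y * ([ suc m ]⟨ x , y ⟩ * B)
      ≈⟨ solve 6 (λ x b k a y k′ → x :* b :+ k :* a :+ y :* (k′ :* b) := k :* a :+ (x :+ y :* k′) :* b) refl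
           (x ^ suc m) B [ suc (suc m) ]⟨ x , y ⟩ A y [ suc m ]⟨ x , y ⟩ ⟩
    [ suc (suc m) ]⟨ x , y ⟩ * A + (x ^ suc m + y * [ suc m ]⟨ x , y ⟩) * B
      -- When the first flag of the result is set, it was either just picked, with all `suc m`
      -- others after it, or set before and hence worth one factor `y`.
      ≈⟨ +-congˡ (*-congʳ ([suc] (suc m) x y)) ⟨
    [ suc (suc m) ]⟨ x , y ⟩ * A + [ suc (suc m) ]⟨ x , y ⟩ * B
      ≈⟨ distribˡ _ _ _ ⟨
    [ suc (suc m) ]⟨ x , y ⟩ * layer (suc (suc m)) Ψ ∎
    where
    A = layer (suc (suc m)) (Ψ ∘ (false ∷_))
    B = layer (suc m) (Ψ ∘ (true ∷_))

  guard : Bool → Carrier → Carrier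
  guard used x = if used then 0# else x

  guard-cong : ∀ b {x y} → (b ≡ false → x ≈ y) → guard b x ≈ guard b y
  guard-cong true  x≈y = refl
  guard-cong false x≈y = x≈y ≡.refl

  guard-* : ∀ b k x → guard b (k * x) ≈ k * guard b x
  guard-* true  k x = sym (zeroʳ k)
  guard-* false k x = refl

  prefix-*ˡ : ∀ k j F → prefix j (λ v → k * F v) ≈ k * prefix j F
  prefix-*ˡ k zero    F = sym (zeroʳ k)
  prefix-*ˡ k (suc j) F = trans (+-congʳ (prefix-*ˡ k j F)) (sym (distribˡ k _ _))

  range-*ˡ : ∀ k q N F → range q N (λ v → k * F v) ≈ k * range q N F
  range-*ˡ k q zero    F = sym (zeroʳ k)
  range-*ˡ k q (suc N) F = trans (+-congˡ (range-*ˡ k (suc q) N F)) (sym (distribˡ k _ _))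

  sumᴸ-*ˡ : ∀ {A : Set} k (xs : List A) F → sumᴸ xs (λ x → k * F x) ≈ k * sumᴸ xs F
  sumᴸ-*ˡ k []       F = sym (zeroʳ k)
  sumᴸ-*ˡ k (x ∷ xs) F = trans (+-congˡ (sumᴸ-*ˡ k xs F)) (sym (distribˡ k _ _))

  lower : Carrier → Carrier → ℕ → (ℕ → Bool) → ℕ → Carrier
  lower x y j U v = x ^ #prefix j (λ v′ → not (U v′) ∧ (v′ <ᵇ v)) * y ^ #prefix j (λ v′ → not (U v′) ∧ (v <ᵇ v′))

  upper : Carrier → Carrier → ℕ → ℕ → (ℕ → Bool) → ℕ → Carrier
  upper x y q N U v = x ^ #range q N (λ v′ → U v′ ∧ (v <ᵇ v′)) * y ^ #range q N (λ v′ → U v′ ∧ (v′ <ᵇ v))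

  prefix-lower : ∀ x y j U → prefix j (λ v → guard (U v) (lower x y j U v)) ≈ [ unused U j ]⟨ x , y ⟩
  prefix-lower x y zero    U = refl
  prefix-lower x y (suc j) U = trans (+-cong (prefix-cong j rest) last) (total (U j))
    where
    m = unused U j

    rest : ∀ v → v ℕ.< j → guard (U v) (lower x y (suc j) U v) ≈ y ^ ⟦ not (U j) ⟧ * guard (U v) (lower x y j U v)
    rest v v<j rewrite <ᵇ-false (ℕₚ.<⇒≤ v<j) | <ᵇ-true v<j | ∧-zeroʳ (not (U j)) | ∧-identityʳ (not (U j)) =
      trans (guard-cong (U v) λ _ → begin
        x ^ (E ℕ.+ 0) * y ^ (D ℕ.+ k)
          ≈⟨ *-cong (reflexive (≡.cong (x ^_) (ℕₚ.+-identityʳ E))) (^-homo-* y D k) ⟩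
        x ^ E * (y ^ D * y ^ k)
          ≈⟨ solve 3 (λ p q s → p :* (q :* s) := s :* (p :* q)) refl (x ^ E) (y ^ D) (y ^ k) ⟩
        y ^ k * (x ^ E * y ^ D) ∎)
      (guard-* (U v) _ _)
      where
      E = #prefix j (λ v′ → not (U v′) ∧ (v′ <ᵇ v))
      D = #prefix j (λ v′ → not (U v′) ∧ (v <ᵇ v′))
      k = ⟦ not (U j) ⟧

    last : guard (U j) (lower x y (suc j) U j) ≈ guard (U j) (x ^ m)
    last rewrite <ᵇ-false (ℕₚ.≤-refl {j}) | ∧-zeroʳ (not (U j)) = guard-cong (U j) λ _ → begin
      x ^ (E ℕ.+ 0) * y ^ (D ℕ.+ 0)
        ≈⟨ *-cong (reflexive (≡.cong (x ^_) (≡.trans (ℕₚ.+-identityʳ E) (#prefix-cong j λ v v<j →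
                    ≡.trans (≡.cong (not (U v) ∧_) (<ᵇ-true v<j)) (∧-identityʳ _)))))
                  (reflexive (≡.cong (y ^_) (≡.trans (ℕₚ.+-identityʳ D) (#prefix-false j λ v v<j →
                    ≡.trans (≡.cong (not (U v) ∧_) (<ᵇ-false (ℕₚ.<⇒≤ v<j))) (∧-zeroʳ _))))) ⟩
      x ^ m * 1# ≈⟨ *-identityʳ _ ⟩
      x ^ m      ∎
      where
      E = #prefix j (λ v′ → not (U v′) ∧ (v′ <ᵇ j))
      D = #prefix j (λ v′ → not (U v′) ∧ (j <ᵇ v′))

    total : ∀ b → prefix j (λ v → y ^ ⟦ not b ⟧ * guard (U v) (lower x y j U v)) + guard b (x ^ m)
                  ≈ [ m ℕ.+ ⟦ not b ⟧ ]⟨ x , y ⟩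
    total b = trans (+-congʳ (trans (prefix-*ˡ _ j _) (*-congˡ (prefix-lower x y j U)))) (total′ b)
      where
      total′ : ∀ b → y ^ ⟦ not b ⟧ * [ m ]⟨ x , y ⟩ + guard b (x ^ m) ≈ [ m ℕ.+ ⟦ not b ⟧ ]⟨ x , y ⟩
      total′ true  rewrite ℕₚ.+-identityʳ m = trans (+-identityʳ _) (*-identityˡ _)
      total′ false rewrite ℕₚ.+-comm m 1    =
        trans (+-comm _ _) (trans (+-congˡ (*-congʳ (*-identityʳ y))) (sym ([suc] m x y)))

  -- Using the value `v` sets its flag. Splitting off the smallest value `q` matches the recursion
  -- of `pick`: if `q` is used, it lies before every later choice and costs one `y`.
  range-upper : ∀ x y q N U Ψ →
    range q N (λ v → guard (U v) (upper x y q N U v * Ψ (flags (add v U) q N))) ≈ pick x y (flags U q N) Ψ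
  range-upper x y q zero    U Ψ = refl
  range-upper x y q (suc N) U Ψ = begin
    range q (suc N) (λ v → guard (U v) (upper x y q (suc N) U v * Ψ (flags (add v U) q (suc N))))
      ≈⟨ +-cong first (range-cong (suc q) N rest) ⟩
    guard (U q) (x ^ #true z * Ψ (true ∷ z))
      + range (suc q) N (λ v → y ^ ⟦ U q ⟧ * guard (U v) (upper x y (suc q) N U v * Ψ (U q ∷ flags (add v U) (suc q) N)))
      ≈⟨ +-congˡ (trans (range-*ˡ _ (suc q) N _) (*-congˡ (range-upper x y (suc q) N U (Ψ ∘ (U q ∷_))))) ⟩
    guard (U q) (x ^ #true z * Ψ (true ∷ z)) + y ^ ⟦ U q ⟧ * pick x y z (Ψ ∘ (U q ∷_))
      ≈⟨ total (U q) ⟩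
    pick x y (U q ∷ z) Ψ ∎
    where
    z = flags U (suc q) N

    total : ∀ b → guard b (x ^ #true z * Ψ (true ∷ z)) + y ^ ⟦ b ⟧ * pick x y z (Ψ ∘ (b ∷_)) ≈ pick x y (b ∷ z) Ψ
    total true  = trans (+-identityˡ _) (*-congʳ (*-identityʳ y))
    total false = +-congˡ (*-identityˡ _)

    first : guard (U q) (upper x y q (suc N) U q * Ψ (flags (add q U) q (suc N))) ≈ guard (U q) (x ^ #true z * Ψ (true ∷ z))
    first rewrite <ᵇ-false (ℕₚ.≤-refl {q}) | ∧-zeroʳ (U q) | add-≡ q U | flags-add-< U N (ℕₚ.n<1+n q) =
      guard-cong (U q) λ _ → *-congʳ (begin
        x ^ #range (suc q) N (λ v′ → U v′ ∧ (q <ᵇ v′)) * y ^ #range (suc q) N (λ v′ → U v′ ∧ (v′ <ᵇ q))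
          ≈⟨ *-cong (reflexive (≡.cong (x ^_) (≡.trans
                      (#range-cong (suc q) N λ v q<v → ≡.trans (≡.cong (U v ∧_) (<ᵇ-true q<v)) (∧-identityʳ _))
                      (≡.sym (#true-flags U (suc q) N)))))
                    (reflexive (≡.cong (y ^_) (#range-false (suc q) N λ v q<v →
                      ≡.trans (≡.cong (U v ∧_) (<ᵇ-false (ℕₚ.<⇒≤ q<v))) (∧-zeroʳ _)))) ⟩
        x ^ #true z * 1# ≈⟨ *-identityʳ _ ⟩
        x ^ #true z      ∎)

    rest : ∀ v → q ℕ.< v → guard (U v) (upper x y q (suc N) U v * Ψ (flags (add v U) q (suc N)))
             ≈ y ^ ⟦ U q ⟧ * guard (U v) (upper x y (suc q) N U v * Ψ (U q ∷ flags (add v U) (suc q) N))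
    rest v q<v rewrite <ᵇ-false (ℕₚ.<⇒≤ q<v) | <ᵇ-true q<v | ∧-zeroʳ (U q) | ∧-identityʳ (U q) | add-≢ U (≡.≢-sym (ℕₚ.<⇒≢ q<v)) =
      trans (guard-cong (U v) λ _ → begin
        x ^ E * y ^ (k ℕ.+ D) * ψ   ≈⟨ *-congʳ (*-congˡ (^-homo-* y k D)) ⟩
        x ^ E * (y ^ k * y ^ D) * ψ ≈⟨ solve 4 (λ p q s t → p :* (s :* q) :* t := s :* (p :* q :* t)) refl (x ^ E) (y ^ D) (y ^ k) ψ ⟩
        y ^ k * (x ^ E * y ^ D * ψ) ∎)
      (guard-* (U v) _ _)
      where
      E = #range (suc q) N (λ v′ → U v′ ∧ (v <ᵇ v′))
      D = #range (suc q) N (λ v′ → U v′ ∧ (v′ <ᵇ v))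
      k = ⟦ U q ⟧
      ψ = Ψ (U q ∷ flags (add v U) (suc q) N)

-- The sum over all permutations

if-true : ∀ {ℓ} {A : Set ℓ} {b} {x y : A} → b ≡ true → (if b then x else y) ≡ x
if-true ≡.refl = ≡.refl

if-false : ∀ {ℓ} {A : Set ℓ} {b} {x y : A} → b ≡ false → (if b then x else y) ≡ y
if-false ≡.refl = ≡.refl

module Enumeration {e ℓ} (R : CommutativeRing e ℓ)
                   (a b c d f g h l p r s t u w : CommutativeRing.Carrier R) where
  open CommutativeRing R hiding (zero)
  open PowerSeries R
  open Motzkin R using (paths)
  open Transfer R
  open RangeSum +-commutativeMonoid
  open import Algebra.Properties.Semiring.Sum semiring using (sum-cong-≋; sum-remove)
  open import Algebra.Solver.Ring.NaturalCoefficients.Default commutativeSemiring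
    using (solve; _:=_; _:+_; _:*_)
  open import Relation.Binary.Reasoning.Setoid setoid

  up down : ℕ → Carrier
  up   m = p * [ m ]⟨ c , d ⟩
  down m = r * [ m ]⟨ h , l ⟩

  -- Total weight of the ways to place the positions j, j + 1, …, j + N - 1 when m values
  -- below j are unused and the flags tell which of the values from j on are used.
  transfer : ∀ {N} → ℕ → Vec Bool N → Carrier
  transfer m []          = 1#
  transfer m (false ∷ x) = u * (w ^ #true x * transfer m x) + t * [ m ]⟨ f , g ⟩ * transfer m x
                             + p * pick c d x (transfer (suc m))
  transfer m (true  ∷ x) = down m * transfer (m ∸ 1) x + s * pick a b x (transfer m)

  layer-transfer-false : ∀ m N → layer m {N} (transfer m ∘ (false ∷_)) ≈
    (u * w ^ m + t * [ m ]⟨ f , g ⟩) * layer m {N} (transfer m) + up (suc m) * layer (suc m) {N} (transfer (suc m))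
  layer-transfer-false m N = begin
    layer m {N} (transfer m ∘ (false ∷_))
      ≈⟨ trans (layer-+ m {N} _ _) (+-cong (layer-+ m {N} _ _) (layer-* m p {N} _)) ⟩
    layer m {N} (λ x → u * (w ^ #true x * transfer m x)) + layer m {N} (λ x → t * [ m ]⟨ f , g ⟩ * transfer m x)
      + p * layer m {N} (λ x → pick c d x (transfer (suc m)))
      ≈⟨ +-cong (+-cong (trans (layer-* m u {N} _) (*-congˡ (layer-^ w m {N} _))) (layer-* m _ {N} _))
                (trans (*-congˡ (layer-pick c d m {N} _)) (sym (*-assoc _ _ _))) ⟩
    u * (w ^ m * L) + t * [ m ]⟨ f , g ⟩ * L + up (suc m) * _
      ≈⟨ +-congʳ (trans (distribʳ _ _ _) (+-congʳ (*-assoc _ _ _))) ⟨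
    (u * w ^ m + t * [ m ]⟨ f , g ⟩) * L + up (suc m) * _ ∎
    where
    L = layer m {N} (transfer m)

  -- The first flag is one of the `suc m` set flags, so the rest lies in layer `m`, and the height
  -- is positive, which makes `suc m ∸ 1` a true predecessor.
  layer-transfer-true : ∀ m N → layer m {N} (transfer (suc m) ∘ (true ∷_)) ≈
    down (suc m) * layer m {N} (transfer m) + s * [ suc m ]⟨ a , b ⟩ * layer (suc m) {N} (transfer (suc m))
  layer-transfer-true m N = trans (layer-+ m {N} _ _) (+-cong (layer-* m _ {N} _)
    (trans (layer-* m s {N} _) (trans (*-congˡ (layer-pick a b m {N} _)) (sym (*-assoc _ _ _)))))

  layer-transfer : ∀ N m → layer m {N} (transfer m) ≈ paths (𝒞-α a b f g s t u w) up down N m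
  layer-transfer zero    zero    = refl
  layer-transfer zero    (suc m) = refl
  layer-transfer (suc N) zero    = trans (layer-transfer-false 0 N)
    (+-cong (*-cong (+-congʳ (sym (trans (+-congˡ (zeroʳ s)) (+-identityʳ _)))) (layer-transfer N 0))
            (*-congˡ (layer-transfer N 1)))
  layer-transfer (suc N) (suc m) = begin
    layer (suc m) {N} (transfer (suc m) ∘ (false ∷_)) + layer m {N} (transfer (suc m) ∘ (true ∷_))
      ≈⟨ +-cong (layer-transfer-false (suc m) N) (layer-transfer-true m N) ⟩
    (A + C) * L₁ + up (suc (suc m)) * L₂ + (down (suc m) * L₀ + B * L₁)
      ≈⟨ solve 8 (λ a b c l₀ l₁ l₂ x y → (a :+ c) :* l₁ :+ x :* l₂ :+ (y :* l₀ :+ b :* l₁)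
           := (a :+ b :+ c) :* l₁ :+ x :* l₂ :+ y :* l₀) refl A B C L₀ L₁ L₂ (up (suc (suc m))) (down (suc m)) ⟩
    (A + B + C) * L₁ + up (suc (suc m)) * L₂ + down (suc m) * L₀
      ≈⟨ +-cong (+-cong (*-congˡ (layer-transfer N (suc m))) (*-congˡ (layer-transfer N (suc (suc m)))))
                (*-congˡ (layer-transfer N m)) ⟩
    paths (𝒞-α a b f g s t u w) up down (suc N) (suc m) ∎
    where
    A  = u * w ^ suc m
    B  = s * [ suc m ]⟨ a , b ⟩
    C  = t * [ suc m ]⟨ f , g ⟩
    L₀ = layer m {N} (transfer m)
    L₁ = layer (suc m) {N} (transfer (suc m))
    L₂ = layer (suc (suc m)) {N} (transfer (suc (suc m)))

  -- The factor contributed by position j with value v, when U marks the values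
  -- of the earlier positions and N positions follow.
  weight : ℕ → ℕ → (ℕ → Bool) → ℕ → Carrier
  weight N j U v =
    if v <ᵇ j then (if U j then r * lower h l j U v else t * lower f g j U v)
    else if j <ᵇ v then (if U j then s * upper a b (suc j) N U v else p * upper c d (suc j) N U v)
    else u * w ^ #range (suc j) N U

  weight-lower : ∀ N j U v → v ℕ.< j →
                 weight N j U v ≡ (if U j then r * lower h l j U v else t * lower f g j U v)
  weight-lower N j U v v<j rewrite <ᵇ-true v<j = ≡.refl

  weight-upper : ∀ N j U v → j ℕ.< v →
                 weight N j U v ≡ (if U j then s * upper a b (suc j) N U v else p * upper c d (suc j) N U v)
  weight-upper N j U v j<v rewrite <ᵇ-false (ℕₚ.<⇒≤ j<v) | <ᵇ-true j<v = ≡.refl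

  weight-fixed : ∀ N j U → weight N j U j ≡ u * w ^ #range (suc j) N U
  weight-fixed N j U rewrite <ᵇ-false (ℕₚ.≤-refl {j}) = ≡.refl

  prefix-lower-const : ∀ x y k X j U → prefix j (λ v → guard (U v) (k * lower x y j U v * X)) ≈ k * [ unused U j ]⟨ x , y ⟩ * X
  prefix-lower-const x y k X j U = begin
    prefix j (λ v → guard (U v) (k * lower x y j U v * X))
      ≈⟨ prefix-cong j (λ v _ → trans (guard-cong (U v) λ _ →
           solve 3 (λ k y x → k :* y :* x := k :* x :* y) refl k (lower x y j U v) X) (guard-* (U v) _ _)) ⟩
    prefix j (λ v → k * X * guard (U v) (lower x y j U v))
      ≈⟨ trans (prefix-*ˡ (k * X) j _) (*-congˡ (prefix-lower x y j U)) ⟩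
    k * X * [ unused U j ]⟨ x , y ⟩
      ≈⟨ solve 3 (λ k y x → k :* x :* y := k :* y :* x) refl k [ unused U j ]⟨ x , y ⟩ X ⟩
    k * [ unused U j ]⟨ x , y ⟩ * X ∎

  range-upper-scaled : ∀ x y k q N U Ψ →
    range q N (λ v → guard (U v) (k * upper x y q N U v * Ψ (flags (add v U) q N))) ≈ k * pick x y (flags U q N) Ψ
  range-upper-scaled x y k q N U Ψ = begin
    range q N (λ v → guard (U v) (k * upper x y q N U v * Ψ (flags (add v U) q N)))
      ≈⟨ range-cong q N (λ v _ → trans (guard-cong (U v) λ _ → *-assoc _ _ _) (guard-* (U v) _ _)) ⟩
    range q N (λ v → k * guard (U v) (upper x y q N U v * Ψ (flags (add v U) q N)))
      ≈⟨ trans (range-*ˡ k q N _) (*-congˡ (range-upper x y q N U Ψ)) ⟩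
    k * pick x y (flags U q N) Ψ ∎

  module _ (N j : ℕ) (U : ℕ → Bool) where
    private
      m = unused U j
      z = flags U (suc j) N

    placed : ℕ → Carrier
    placed v = weight N j U v * transfer (unused (add v U) (suc j)) (flags (add v U) (suc j) N)

    placed-lower-true : U j ≡ true → prefix j (λ v → guard (U v) (placed v)) ≈ down m * transfer (m ∸ 1) z
    placed-lower-true Uj = trans (prefix-cong j λ v v<j → guard-cong (U v) λ Uv →
      *-cong (reflexive (≡.trans (weight-lower N j U v v<j) (if-true Uj)))
             (reflexive (≡.cong₂ transfer (count v v<j Uv) (flags-add-< U N (ℕₚ.m<n⇒m<1+n v<j)))))
      (prefix-lower-const h l r (transfer (m ∸ 1) z) j U)
      where
      count : ∀ v → v ℕ.< j → U v ≡ false → unused (add v U) (suc j) ≡ m ∸ 1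
      count v v<j Uv rewrite add-≢ U (ℕₚ.<⇒≢ v<j) | Uj =
        ≡.trans (ℕₚ.+-identityʳ _) (≡.cong (_∸ 1) (unused-add-< U j v<j Uv))

    placed-lower-false : U j ≡ false → prefix j (λ v → guard (U v) (placed v)) ≈ t * [ m ]⟨ f , g ⟩ * transfer m z
    placed-lower-false Uj = trans (prefix-cong j λ v v<j → guard-cong (U v) λ Uv →
      *-cong (reflexive (≡.trans (weight-lower N j U v v<j) (if-false Uj)))
             (reflexive (≡.cong₂ transfer (count v v<j Uv) (flags-add-< U N (ℕₚ.m<n⇒m<1+n v<j)))))
      (prefix-lower-const f g t (transfer m z) j U)
      where
      count : ∀ v → v ℕ.< j → U v ≡ false → unused (add v U) (suc j) ≡ m
      count v v<j Uv rewrite add-≢ U (ℕₚ.<⇒≢ v<j) | Uj = ≡.trans (ℕₚ.+-comm _ 1) (unused-add-< U j v<j Uv)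

    placed-fixed : placed j ≈ u * (w ^ #true z * transfer m z)
    placed-fixed = trans
      (*-cong (reflexive (≡.trans (weight-fixed N j U) (≡.cong (λ k → u * w ^ k) (≡.sym (#true-flags U (suc j) N)))))
              (reflexive (≡.cong₂ transfer count (flags-add-< U N (ℕₚ.n<1+n j)))))
      (*-assoc _ _ _)
      where
      count : unused (add j U) (suc j) ≡ m
      count rewrite add-≡ j U = ≡.trans (ℕₚ.+-identityʳ _) (unused-add-≥ U j ℕₚ.≤-refl)

    placed-upper-true : U j ≡ true → range (suc j) N (λ v → guard (U v) (placed v)) ≈ s * pick a b z (transfer m)
    placed-upper-true Uj = trans (range-cong (suc j) N λ v j<v → guard-cong (U v) λ _ →
      *-cong (reflexive (≡.trans (weight-upper N j U v j<v) (if-true Uj)))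
             (reflexive (≡.cong (λ k → transfer k (flags (add v U) (suc j) N)) (count v j<v))))
      (range-upper-scaled a b s (suc j) N U (transfer m))
      where
      count : ∀ v → j ℕ.< v → unused (add v U) (suc j) ≡ m
      count v j<v rewrite unused-add-≥ U (suc j) j<v | Uj = ℕₚ.+-identityʳ _

    placed-upper-false : U j ≡ false → range (suc j) N (λ v → guard (U v) (placed v)) ≈ p * pick c d z (transfer (suc m))
    placed-upper-false Uj = trans (range-cong (suc j) N λ v j<v → guard-cong (U v) λ _ →
      *-cong (reflexive (≡.trans (weight-upper N j U v j<v) (if-false Uj)))
             (reflexive (≡.cong (λ k → transfer k (flags (add v U) (suc j) N)) (count v j<v))))
      (range-upper-scaled c d p (suc j) N U (transfer (suc m)))
      where
      count : ∀ v → j ℕ.< v → unused (add v U) (suc j) ≡ suc m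
      count v j<v rewrite unused-add-≥ U (suc j) j<v | Uj = ℕₚ.+-comm _ 1

    -- The values below, at and above `j` give the terms of `transfer`. A used `j` cannot be a fixed
    -- point, and the guard at `v = j` removes that term.
    range-placed : range 0 (j ℕ.+ suc N) (λ v → guard (U v) (placed v)) ≈ transfer m (flags U j (suc N))
    range-placed = trans (prefix-range j (suc N) _) (cases (U j) ≡.refl)
      where
      cases : ∀ b → U j ≡ b →
              prefix j (λ v → guard (U v) (placed v)) + (guard (U j) (placed j) + range (suc j) N (λ v → guard (U v) (placed v)))
                ≈ transfer m (U j ∷ z)
      cases true  Uj = trans
        (+-cong (placed-lower-true Uj) (trans (+-cong (reflexive (if-true Uj)) (placed-upper-true Uj)) (+-identityˡ _)))
        (reflexive (≡.cong (λ b → transfer m (b ∷ z)) (≡.sym Uj)))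
      cases false Uj = trans
        (+-cong (placed-lower-false Uj)
                (+-cong (trans (reflexive (if-false Uj)) placed-fixed) (placed-upper-false Uj)))
        (trans (solve 3 (λ x y z → x :+ (y :+ z) := y :+ x :+ z) refl
                 (t * [ m ]⟨ f , g ⟩ * transfer m z) (u * (w ^ #true z * transfer m z)) (p * pick c d z (transfer (suc m))))
               (reflexive (≡.cong (λ b → transfer m (b ∷ z)) (≡.sym Uj))))

  run : ∀ N → ℕ → (ℕ → Bool) → (Fin N → ℕ) → Carrier
  run zero    j U τ = 1#
  run (suc N) j U τ = weight N j U (τ zero) * run N (suc j) (add (τ zero) U) (τ ∘ suc)

  run-cong : ∀ N j U {τ τ′} → (∀ i → τ i ≡ τ′ i) → run N j U τ ≡ run N j U τ′
  run-cong zero    j U τ≡τ′ = ≡.refl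
  run-cong (suc N) j U τ≡τ′ rewrite τ≡τ′ zero = ≡.cong (_ *_) (run-cong N (suc j) _ (τ≡τ′ ∘ suc))

  -- ι lists the unused values among the n smallest.
  record Lists {N} (n : ℕ) (ι : Fin N → ℕ) (U : ℕ → Bool) : Set (e ⊔ ℓ) where
    field
      injective : Injective _≡_ _≡_ ι
      sum-ι     : ∀ F → sum (F ∘ ι) ≈ range 0 n (λ v → guard (U v) (F v))

  open Lists

  -- The old property is applied to `F′`, which vanishes at `ι i` and agrees with `F` elsewhere.
  -- Injectivity ensures that only the removed term vanishes.
  Lists-remove : ∀ {N n} {ι : Fin (suc N) → ℕ} {U} → Lists n ι U → ∀ i → Lists n (ι ∘ Fin.punchIn i) (add (ι i) U)
  Lists-remove {N} {n} {ι} {U} L i .injective = punchIn-injective i _ _ ∘ injective L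
  Lists-remove {N} {n} {ι} {U} L i .sum-ι F   = begin
    sum (F ∘ ι ∘ Fin.punchIn i)
      ≈⟨ sum-cong-≋ {N} (λ k → reflexive (≡.sym (if-false
           (dec-false (ι i ℕₚ.≟ ι (Fin.punchIn i k)) (λ eq → punchInᵢ≢i i k (≡.sym (injective L eq))))))) ⟩
    sum (F′ ∘ ι ∘ Fin.punchIn i)
      ≈⟨ trans (+-congʳ (reflexive (if-true (dec-true (ι i ℕₚ.≟ ι i) ≡.refl)))) (+-identityˡ _) ⟨
    F′ (ι i) + sum (F′ ∘ ι ∘ Fin.punchIn i)
      ≈⟨ sum-remove {N} {i} (F′ ∘ ι) ⟨
    sum (F′ ∘ ι)
      ≈⟨ sum-ι L F′ ⟩
    range 0 n (λ v → guard (U v) (F′ v))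
      ≈⟨ range-cong 0 n (λ v _ → merge (does (ι i ℕₚ.≟ v)) (U v)) ⟩
    range 0 n (λ v → guard (add (ι i) U v) (F v)) ∎
    where
    F′ : ℕ → Carrier
    F′ v = guard (does (ι i ℕₚ.≟ v)) (F v)

    merge : ∀ b b′ {x} → guard b′ (guard b x) ≈ guard (if b then true else b′) x
    merge true  true  = refl
    merge true  false = refl
    merge false b′    = refl

  -- The induction follows the enumeration: `Perm.insert zero v π` begins with `v` and continues
  -- with `π` relabelled by `punchIn v`. Absorbing the relabelling into `ι` keeps the actual values
  -- in sight.
  sum-run : ∀ N j U ι → Lists (j ℕ.+ N) ι U →
            sumᴸ (permutations N) (λ π → run N j U (λ i → ι (π ⟨$⟩ʳ i))) ≈ transfer (unused U j) (flags U j N)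
  sum-run zero    j U ι L = +-identityʳ _
  sum-run (suc N) j U ι L = begin
    sumᴸ (permutations (suc N)) (λ π → run (suc N) j U (λ i → ι (π ⟨$⟩ʳ i)))
      ≈⟨ sumᴸ-cartesianProductWith (Perm.insert zero) (allFin (suc N)) (permutations N) _ ⟩
    sumᴸ (allFin (suc N)) (λ v → sumᴸ (permutations N) (λ π → run (suc N) j U (λ i → ι (Perm.insert zero v π ⟨$⟩ʳ i))))
      ≈⟨ reflexive (sumᴸ-tabulate {n = suc N} id _) ⟩
    ∑[ v < suc N ] sumᴸ (permutations N) (λ π → run (suc N) j U (λ i → ι (Perm.insert zero v π ⟨$⟩ʳ i)))
      ≈⟨ sum-cong-≋ {suc N} first ⟩
    ∑[ v < suc N ] placed N j U (ι v)
      ≈⟨ sum-ι L (placed N j U) ⟩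
    range 0 (j ℕ.+ suc N) (λ v → guard (U v) (placed N j U v))
      ≈⟨ range-placed N j U ⟩
    transfer (unused U j) (flags U j (suc N)) ∎
    where
    first : ∀ v → sumᴸ (permutations N) (λ π → run (suc N) j U (λ i → ι (Perm.insert zero v π ⟨$⟩ʳ i))) ≈ placed N j U (ι v)
    first v = begin
      sumᴸ (permutations N) (λ π → run (suc N) j U (λ i → ι (Perm.insert zero v π ⟨$⟩ʳ i)))
        ≈⟨ sumᴸ-cong (permutations N) (λ π → *-congˡ (reflexive (run-cong N (suc j) (add (ι v) U) λ i →
             ≡.cong ι (Perm.insert-punchIn zero v π i)))) ⟩
      sumᴸ (permutations N) (λ π → weight N j U (ι v) * run N (suc j) (add (ι v) U) (λ i → ι (Fin.punchIn v (π ⟨$⟩ʳ i))))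
        ≈⟨ sumᴸ-*ˡ _ (permutations N) _ ⟩
      weight N j U (ι v) * sumᴸ (permutations N) (λ π → run N (suc j) (add (ι v) U) (λ i → ι (Fin.punchIn v (π ⟨$⟩ʳ i))))
        ≈⟨ *-congˡ (sum-run N (suc j) (add (ι v) U) (ι ∘ Fin.punchIn v)
             (≡.subst (λ n → Lists n (ι ∘ Fin.punchIn v) (add (ι v) U)) (ℕₚ.+-suc j N) (Lists-remove L v))) ⟩
      placed N j U (ι v) ∎

  ∅ : ℕ → Bool
  ∅ _ = false

  -- At the start nothing is used, and the empty set is the only member of layer 0. A single value
  -- of `transfer` is therefore a sum over a layer, to which the path recursion applies.
  sum-run-paths : ∀ n → sumᴸ (permutations n) (λ π → run n 0 ∅ (λ i → toℕ (π ⟨$⟩ʳ i)))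
                        ≈ paths (𝒞-α a b f g s t u w) up down n 0
  sum-run-paths n = begin
    sumᴸ (permutations n) (λ π → run n 0 ∅ (λ i → toℕ (π ⟨$⟩ʳ i)))
      ≈⟨ sum-run n 0 ∅ toℕ (record { injective = toℕ-injective ; sum-ι = sum-range 0 n }) ⟩
    transfer 0 (flags ∅ 0 n)
      ≈⟨ layer-zero 0 n (transfer 0) ⟨
    layer 0 {n} (transfer 0)
      ≈⟨ layer-transfer n 0 ⟩
    paths (𝒞-α a b f g s t u w) up down n 0 ∎

-- The statistics as sums over positions

length-filter : ∀ {A : Set} {P : A → Set} (P? : Decidable P) xs →
                length (filter P? xs) ≡ sumᴸℕ xs (λ x → ⟦ does (P? x) ⟧)
length-filter P? []       = ≡.refl
length-filter P? (x ∷ xs) with does (P? x)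
... | true  = ≡.cong suc (length-filter P? xs)
... | false = length-filter P? xs

#₁-sum : ∀ {n} {P : Fin n → Set} (P? : Decidable P) → #₁ P? ≡ sumℕ (λ i → ⟦ does (P? i) ⟧)
#₁-sum {n} P? = ≡.trans (length-filter P? (allFin _)) (sumᴸℕ-tabulate {n = n} id _)

#₂-sum : ∀ {n} {P : Fin n → Fin n → Set} (P? : ∀ i j → Dec (P i j)) →
         #₂ P? ≡ sumℕ (λ i → sumℕ (λ j → ⟦ does (P? i j) ⟧))
#₂-sum {n} P? = begin
  #₂ P?
    ≡⟨ length-filter (uncurry P?) (cartesianProduct (allFin n) (allFin n)) ⟩
  sumᴸℕ (cartesianProduct (allFin n) (allFin n)) (λ ij → ⟦ does (uncurry P? ij) ⟧)
    ≡⟨ sumᴸℕ-cartesianProductWith _,_ (allFin n) (allFin n) _ ⟩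
  sumᴸℕ (allFin n) (λ i → sumᴸℕ (allFin n) (λ j → ⟦ does (P? i j) ⟧))
    ≡⟨ sumᴸℕ-tabulate {n = n} id _ ⟩
  sumℕ (λ i → sumᴸℕ (allFin n) (λ j → ⟦ does (P? i j) ⟧))
    ≡⟨ sumℕ-cong {n} (λ i → sumᴸℕ-tabulate {n = n} id _) ⟩
  sumℕ (λ i → sumℕ (λ j → ⟦ does (P? i j) ⟧)) ∎
  where
  open ≡.≡-Reasoning

infix 5 _when_
_when_ : ℕ → Bool → ℕ
x when b = if b then x else 0

#true-∧ : ∀ {n} (P Q : Fin n → Bool) c → (∀ i → P i ≡ Q i ∧ c) →
          sumℕ (λ i → ⟦ P i ⟧) ≡ (sumℕ (λ i → ⟦ Q i ⟧) when c)
#true-∧ {n} P Q true  P≡ = sumℕ-cong {n} λ i → ≡.cong ⟦_⟧ (≡.trans (P≡ i) (∧-identityʳ _))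
#true-∧ {n} P Q false P≡ = ≡.trans (sumℕ-cong {n} λ i → ≡.cong ⟦_⟧ (≡.trans (P≡ i) (∧-zeroʳ _))) (sumℕ-0 n)

⟦⟧-split : ∀ b c → ⟦ b ⟧ ≡ ⟦ b ∧ c ⟧ ℕ.+ ⟦ b ∧ not c ⟧
⟦⟧-split true  true  = ≡.refl
⟦⟧-split true  false = ≡.refl
⟦⟧-split false c     = ≡.refl

when-split : ∀ x b c → (x when b) ≡ (x when b ∧ c) ℕ.+ (x when b ∧ not c)
when-split x true  true  = ≡.sym (ℕₚ.+-identityʳ x)
when-split x true  false = ≡.refl
when-split x false c     = ≡.refl

∧-rotate : ∀ x y b → x ∧ (b ∧ y) ≡ (x ∧ y) ∧ b
∧-rotate false y b     = ≡.refl
∧-rotate true  y false = ≡.sym (∧-zeroʳ y)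
∧-rotate true  y true  = ≡.sym (∧-identityʳ y)

∧-rotate₂ : ∀ x y b c → (x ∧ (b ∧ y)) ∧ c ≡ (x ∧ y) ∧ (b ∧ c)
∧-rotate₂ x y b c = ≡.trans (≡.cong (_∧ c) (∧-rotate x y b)) (∧-assoc (x ∧ y) b c)

∧-absorb : ∀ {b c} → (b ≡ true → c ≡ true) → b ≡ b ∧ c
∧-absorb {false} b⇒c = ≡.refl
∧-absorb {true}  b⇒c = ≡.sym (b⇒c ≡.refl)

∧-true : ∀ {b c} → b ∧ c ≡ true → b ≡ true × c ≡ true
∧-true {true} c = ≡.refl , c

<ᵇ⇒< : ∀ m n → (m <ᵇ n) ≡ true → m ℕ.< n
<ᵇ⇒< m n eq = ℕₚ.<ᵇ⇒< m n (≡.subst T (≡.sym eq) _)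

<ᵇ-trans : ∀ i j k → (i <ᵇ j) ∧ (j <ᵇ k) ≡ true → (i <ᵇ k) ≡ true
<ᵇ-trans i j k eq with i<j , j<k ← ∧-true eq = <ᵇ-true (ℕₚ.<-trans (<ᵇ⇒< i j i<j) (<ᵇ⇒< j k j<k))

0-+ : ∀ {x y} → x ≡ 0 → x ℕ.+ y ≡ y
0-+ ≡.refl = ≡.refl

+-0 : ∀ {x y} → y ≡ 0 → x ℕ.+ y ≡ x
+-0 {x} ≡.refl = ℕₚ.+-identityʳ x

<ᵇ-flip : ∀ {i j} → i ≢ j → (i <ᵇ j) ≡ not (j <ᵇ i)
<ᵇ-flip {i} {j} i≢j with ℕₚ.<-cmp i j
... | tri< i<j _ _ rewrite <ᵇ-true i<j | <ᵇ-false (ℕₚ.<⇒≤ i<j) = ≡.refl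
... | tri≈ _ i≡j _ = contradiction i≡j i≢j
... | tri> _ _ j<i rewrite <ᵇ-true j<i | <ᵇ-false (ℕₚ.<⇒≤ j<i) = ≡.refl

used : ∀ {N} → (ℕ → Bool) → (Fin N → ℕ) → Fin N → ℕ → Bool
used U τ zero    = U
used U τ (suc i) = used (add (τ zero) U) (τ ∘ suc) i

used-⊇ : ∀ {N} U (τ : Fin N → ℕ) i v → U v ≡ true → used U τ i v ≡ true
used-⊇ U τ zero    v Uv = Uv
used-⊇ U τ (suc i) v Uv = used-⊇ (add (τ zero) U) (τ ∘ suc) i v (add-⊇ (does (τ zero ℕₚ.≟ v)))
  where
  add-⊇ : ∀ b → (if b then true else U v) ≡ true
  add-⊇ true  = ≡.refl
  add-⊇ false = Uv

-- Links the set of used values to the order of positions, in which the statistics are phrased. By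
-- injectivity, adding an earlier value never marks a later one.
used-value : ∀ {N} U (τ : Fin N → ℕ) → Injective _≡_ _≡_ τ → (∀ k → U (τ k) ≡ false) →
             ∀ i k → used U τ i (τ k) ≡ (toℕ k <ᵇ toℕ i)
used-value U τ inj Uτ zero    k       = Uτ k
used-value U τ inj Uτ (suc i) zero    = used-⊇ (add (τ zero) U) (τ ∘ suc) i (τ zero) (add-≡ (τ zero) U)
used-value U τ inj Uτ (suc i) (suc k) = used-value (add (τ zero) U) (τ ∘ suc) (Finₚ.suc-injective ∘ inj)
  (λ k → ≡.trans (add-≢ U (λ eq → Finₚ.0≢1+n (inj eq))) (Uτ (suc k))) i k

module Statistics {n} (σ : Permutation′ n) where

  usedBefore : Fin n → ℕ → Bool
  usedBefore = used (λ _ → false) (λ i → toℕ (σ ⟨$⟩ʳ i))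

  σ-injective : Injective _≡_ _≡_ (σ ⟨$⟩ʳ_)
  σ-injective {i} {j} eq = ≡.trans (≡.sym (Perm.inverseˡ σ)) (≡.trans (≡.cong (σ ⟨$⟩ˡ_) eq) (Perm.inverseˡ σ))

  usedBefore-σ : ∀ j i → usedBefore j (toℕ (σ ⟨$⟩ʳ i)) ≡ (toℕ i <ᵇ toℕ j)
  usedBefore-σ = used-value _ _ (σ-injective ∘ toℕ-injective) λ _ → ≡.refl

  private
    σ⁺ σ⁻ : Fin n → Fin n
    σ⁺ = σ ⟨$⟩ʳ_
    σ⁻ = σ ⟨$⟩ˡ_

    infix 7 _<_
    _<_ : Fin n → Fin n → Bool
    i < j = toℕ i <ᵇ toℕ j

  up dn fix lin alin : Fin n → Bool
  up   j = j < σ⁺ j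
  dn   j = σ⁺ j < j
  fix  j = does (j Finₚ.≟ σ⁺ j)
  lin  j = σ⁻ j < j
  alin j = j < σ⁻ j

  -- `j` is the value at position `σ⁻ j`; hence the case distinction on `U j` in `weight` is the one
  -- that defines `le` and `lae`.
  usedBefore-self : ∀ j → usedBefore j (toℕ j) ≡ lin j
  usedBefore-self j = ≡.trans (≡.cong (usedBefore j ∘ toℕ) (≡.sym (Perm.inverseʳ σ))) (usedBefore-σ j (σ⁻ j))

  -- Pairs charged to one position: the later one for `nested` and `crossed`, the earlier one for
  -- `anested` and `acrossed`. The type of that position is left out, so that `nested` serves `ie`,
  -- `ile` and `iefp` alike.
  nested crossed anested acrossed : Fin n → ℕ
  nested   j = sumℕ λ i → ⟦ i < j ∧ σ⁺ j < σ⁺ i ⟧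
  crossed  j = sumℕ λ i → ⟦ i < j ∧ (j < σ⁺ i ∧ σ⁺ i < σ⁺ j) ⟧
  anested  i = sumℕ λ j → ⟦ i < j ∧ σ⁺ j < σ⁺ i ⟧
  acrossed i = sumℕ λ j → ⟦ i < j ∧ (σ⁺ j < i ∧ σ⁺ i < σ⁺ j) ⟧

  le-sum : le σ ≡ sumℕ (λ j → ⟦ up j ∧ lin j ⟧)
  le-sum = ≡.trans (#₁-sum {n} _) (sumℕ-cong {n} λ j → ≡.cong ⟦_⟧ (∧-comm (lin j) (up j)))

  lae-sum : lae σ ≡ sumℕ (λ j → ⟦ dn j ∧ alin j ⟧)
  lae-sum = ≡.trans (#₁-sum {n} _) (sumℕ-cong {n} λ j → ≡.cong ⟦_⟧ (∧-comm (alin j) (dn j)))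

  difference : ∀ {P : Fin n → ℕ} {F G : Fin n → ℕ} {x y} → x ≡ sumℕ P → y ≡ sumℕ F →
               (∀ j → P j ≡ F j ℕ.+ G j) → x ∸ y ≡ sumℕ G
  difference {P} {F} {G} ≡.refl ≡.refl P≡F+G =
    ≡.trans (≡.cong (_∸ sumℕ F) (≡.trans (sumℕ-cong {n} P≡F+G) (sumℕ-+ F G))) (ℕₚ.m+n∸m≡n (sumℕ F) (sumℕ G))

  exc∸le-sum : exc σ ∸ le σ ≡ sumℕ (λ j → ⟦ up j ∧ not (lin j) ⟧)
  exc∸le-sum = difference (#₁-sum {n} _) le-sum λ j → ⟦⟧-split (up j) (lin j)

  aexc∸lae-sum : aexc σ ∸ lae σ ≡ sumℕ (λ j → ⟦ dn j ∧ not (alin j) ⟧)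
  aexc∸lae-sum = difference (#₁-sum {n} _) lae-sum λ j → ⟦⟧-split (dn j) (alin j)

  #₂-sum-by-row : {P : Fin n → Fin n → Set} (P? : ∀ i j → Dec (P i j)) (Q : Fin n → Fin n → Bool) (c : Fin n → Bool) →
                  (∀ i j → does (P? i j) ≡ Q i j ∧ c i) → #₂ P? ≡ sumℕ (λ i → sumℕ (λ j → ⟦ Q i j ⟧) when c i)
  #₂-sum-by-row P? Q c eq = ≡.trans (#₂-sum P?) (sumℕ-cong {n} λ i → #true-∧ _ (Q i) (c i) (eq i))

  #₂-sum-by-column : {P : Fin n → Fin n → Set} (P? : ∀ i j → Dec (P i j)) (Q : Fin n → Fin n → Bool) (c : Fin n → Bool) →
                     (∀ i j → does (P? i j) ≡ Q i j ∧ c j) → #₂ P? ≡ sumℕ (λ j → sumℕ (λ i → ⟦ Q i j ⟧) when c j)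
  #₂-sum-by-column P? Q c eq = ≡.trans (#₂-sum P?) (≡.trans (sumℕ-comm {n} {n} _)
    (sumℕ-cong {n} λ j → #true-∧ _ (λ i → Q i j) (c j) (λ i → eq i j)))

  ie-sum : ie σ ≡ sumℕ (λ j → nested j when up j)
  ie-sum = #₂-sum-by-column _ (λ i j → i < j ∧ σ⁺ j < σ⁺ i) up λ i j → ∧-rotate (i < j) _ (up j)

  ile-sum : ile σ ≡ sumℕ (λ j → nested j when up j ∧ lin j)
  ile-sum = #₂-sum-by-column _ (λ i j → i < j ∧ σ⁺ j < σ⁺ i) (λ j → up j ∧ lin j)
    λ i j → ∧-rotate₂ (i < j) _ (up j) (lin j)

  iae-sum : iae σ ≡ sumℕ (λ i → anested i when dn i)
  iae-sum = #₂-sum-by-row _ (λ i j → i < j ∧ σ⁺ j < σ⁺ i) dn λ i j → ∧-rotate (i < j) _ (dn i)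

  ilae-sum : ilae σ ≡ sumℕ (λ i → anested i when dn i ∧ alin i)
  ilae-sum = #₂-sum-by-row _ (λ i j → i < j ∧ σ⁺ j < σ⁺ i) (λ i → dn i ∧ alin i)
    λ i j → ∧-rotate₂ (i < j) _ (dn i) (alin i)

  -- For nestings `up j` is part of the definition, for crossings it only follows from the chain.
  -- Making it explicit lets both be split by the type of `j`.
  crossing⇒up : ∀ i j → i < j ∧ (j < σ⁺ i ∧ σ⁺ i < σ⁺ j) ≡ true → up j ≡ true
  crossing⇒up i j eq with _ , eq′ ← ∧-true {i < j} eq = <ᵇ-trans (toℕ j) (toℕ (σ⁺ i)) (toℕ (σ⁺ j)) eq′

  crossing⇒dn : ∀ i j → i < j ∧ (σ⁺ j < i ∧ σ⁺ i < σ⁺ j) ≡ true → dn i ≡ true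
  crossing⇒dn i j eq with _ , eq′ ← ∧-true {i < j} eq =
    <ᵇ-trans (toℕ (σ⁺ i)) (toℕ (σ⁺ j)) (toℕ i) (≡.trans (∧-comm (σ⁺ i < σ⁺ j) _) eq′)

  nie-sum : nie σ ≡ sumℕ (λ j → crossed j when up j)
  nie-sum = #₂-sum-by-column _ (λ i j → i < j ∧ (j < σ⁺ i ∧ σ⁺ i < σ⁺ j)) up λ i j → ∧-absorb (crossing⇒up i j)

  nile-sum : nile σ ≡ sumℕ (λ j → crossed j when up j ∧ lin j)
  nile-sum = #₂-sum-by-column _ (λ i j → i < j ∧ (j < σ⁺ i ∧ σ⁺ i < σ⁺ j)) (λ j → up j ∧ lin j)
    λ i j → ≡.trans (≡.cong (_∧ lin j) (∧-absorb (crossing⇒up i j))) (∧-assoc _ (up j) (lin j))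

  niae-sum : niae σ ≡ sumℕ (λ i → acrossed i when dn i)
  niae-sum = #₂-sum-by-row _ (λ i j → i < j ∧ (σ⁺ j < i ∧ σ⁺ i < σ⁺ j)) dn λ i j → ∧-absorb (crossing⇒dn i j)

  nilae-sum : nilae σ ≡ sumℕ (λ i → acrossed i when dn i ∧ alin i)
  nilae-sum = #₂-sum-by-row _ (λ i j → i < j ∧ (σ⁺ j < i ∧ σ⁺ i < σ⁺ j)) (λ i → dn i ∧ alin i)
    λ i j → ≡.trans (≡.cong (_∧ alin i) (∧-absorb (crossing⇒dn i j))) (∧-assoc _ (dn i) (alin i))

  iefp-sum : iefp σ ≡ sumℕ (λ j → nested j when fix j)
  iefp-sum = #₂-sum-by-column _ (λ i j → i < j ∧ σ⁺ j < σ⁺ i) fix λ i j → ∧-rotate (i < j) _ (fix j)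

  ie∸ile-sum : ie σ ∸ ile σ ≡ sumℕ (λ j → nested j when up j ∧ not (lin j))
  ie∸ile-sum = difference ie-sum ile-sum λ j → when-split (nested j) (up j) (lin j)

  nie∸nile-sum : nie σ ∸ nile σ ≡ sumℕ (λ j → crossed j when up j ∧ not (lin j))
  nie∸nile-sum = difference nie-sum nile-sum λ j → when-split (crossed j) (up j) (lin j)

  iae∸ilae-sum : iae σ ∸ ilae σ ≡ sumℕ (λ j → anested j when dn j ∧ not (alin j))
  iae∸ilae-sum = difference iae-sum ilae-sum λ j → when-split (anested j) (dn j) (alin j)

  niae∸nilae-sum : niae σ ∸ nilae σ ≡ sumℕ (λ j → acrossed j when dn j ∧ not (alin j))
  niae∸nilae-sum = difference niae-sum nilae-sum λ j → when-split (acrossed j) (dn j) (alin j)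

  -- Reindexing by `σ` turns a count over positions into one over values, the form in which `upper`
  -- and `lower` are given.
  sum-values : ∀ (Q : ℕ → Bool) k → k ℕ.≤ n →
               sumℕ (λ i → ⟦ Q (toℕ (σ⁺ i)) ⟧) ≡ #prefix k Q ℕ.+ #range k (n ∸ k) Q
  sum-values Q k k≤n = begin
    sumℕ (λ i → ⟦ Q (toℕ (σ⁺ i)) ⟧)    ≡⟨ sumℕ-permute (λ v → ⟦ Q (toℕ v) ⟧) σ ⟨
    sumℕ {n} (λ v → ⟦ Q (toℕ v) ⟧)     ≡⟨ sum-rangeℕ 0 n (⟦_⟧ ∘ Q) ⟩
    #range 0 n Q                       ≡⟨ ≡.cong (λ N → #range 0 N Q) (ℕₚ.m+[n∸m]≡n k≤n) ⟨
    #range 0 (k ℕ.+ (n ∸ k)) Q         ≡⟨ prefixℕ-rangeℕ k (n ∸ k) _ ⟩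
    #prefix k Q ℕ.+ #range k (n ∸ k) Q ∎
    where
    open ≡.≡-Reasoning

  module _ (j : Fin n) where
    private
      U = usedBefore j
      N = n ∸ suc (toℕ j)
      v₀ = toℕ (σ⁺ j)

    -- An earlier position is a used value, and a value exceeding `σ j` also exceeds `j`.
    nested-range : toℕ j ℕ.≤ v₀ → nested j ≡ #range (suc (toℕ j)) N (λ v → U v ∧ (v₀ <ᵇ v))
    nested-range j≤v₀ = ≡.trans
      (sumℕ-cong {n} λ i → ≡.cong (λ b → ⟦ b ∧ σ⁺ j < σ⁺ i ⟧) (≡.sym (usedBefore-σ j i)))
      (≡.trans (sum-values (λ v → U v ∧ (v₀ <ᵇ v)) (suc (toℕ j)) (toℕ<n j))
        (0-+ (#prefix-false (suc (toℕ j)) λ v v≤j →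
          ≡.trans (≡.cong (U v ∧_) (<ᵇ-false (ℕₚ.≤-trans (ℕ.s≤s⁻¹ v≤j) j≤v₀))) (∧-zeroʳ _))))

    crossed-range : crossed j ≡ #range (suc (toℕ j)) N (λ v → U v ∧ (v <ᵇ v₀))
    crossed-range = ≡.trans
      (sumℕ-cong {n} λ i → ≡.cong (λ b → ⟦ b ∧ (j < σ⁺ i ∧ σ⁺ i < σ⁺ j) ⟧) (≡.sym (usedBefore-σ j i)))
      (≡.trans (sum-values (λ v → U v ∧ ((toℕ j <ᵇ v) ∧ (v <ᵇ v₀))) (suc (toℕ j)) (toℕ<n j))
        (≡.cong₂ ℕ._+_
          (#prefix-false (suc (toℕ j)) λ v v≤j →
            ≡.trans (≡.cong (λ b → U v ∧ (b ∧ (v <ᵇ v₀))) (<ᵇ-false (ℕ.s≤s⁻¹ v≤j))) (∧-zeroʳ _))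
          (#range-cong (suc (toℕ j)) N λ v j<v → ≡.cong (λ b → U v ∧ (b ∧ (v <ᵇ v₀))) (<ᵇ-true j<v))))

    later : ∀ k z → (k ≡ j → z ≡ false) → j < k ∧ z ≡ not (U (toℕ (σ⁺ k))) ∧ z
    later k z z≡false with k Finₚ.≟ j
    ... | yes k≡j rewrite z≡false k≡j = ≡.trans (∧-zeroʳ _) (≡.sym (∧-zeroʳ _))
    ... | no  k≢j = ≡.cong (_∧ z) (≡.trans (<ᵇ-flip (k≢j ∘ ≡.sym ∘ toℕ-injective)) (≡.cong not (≡.sym (usedBefore-σ j k))))

    anested-prefix : v₀ ℕ.≤ toℕ j → anested j ≡ #prefix (toℕ j) (λ v → not (U v) ∧ (v <ᵇ v₀))
    anested-prefix v₀≤j = ≡.trans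
      (sumℕ-cong {n} λ k → ≡.cong ⟦_⟧ (later k _ λ { ≡.refl → <ᵇ-false (ℕₚ.≤-refl {v₀}) }))
      (≡.trans (sum-values (λ v → not (U v) ∧ (v <ᵇ v₀)) (toℕ j) (ℕₚ.<⇒≤ (toℕ<n j)))
        (+-0 (#range-false (toℕ j) (n ∸ toℕ j) λ v j≤v →
          ≡.trans (≡.cong (not (U v) ∧_) (<ᵇ-false (ℕₚ.≤-trans v₀≤j j≤v))) (∧-zeroʳ _))))

    acrossed-prefix : acrossed j ≡ #prefix (toℕ j) (λ v → not (U v) ∧ (v₀ <ᵇ v))
    acrossed-prefix = ≡.trans
      (sumℕ-cong {n} λ k → ≡.cong ⟦_⟧ (later k _ λ { ≡.refl →
        ≡.trans (≡.cong (dn j ∧_) (<ᵇ-false (ℕₚ.≤-refl {v₀}))) (∧-zeroʳ (dn j)) }))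
      (≡.trans (sum-values (λ v → not (U v) ∧ ((v <ᵇ toℕ j) ∧ (v₀ <ᵇ v))) (toℕ j) (ℕₚ.<⇒≤ (toℕ<n j)))
        (≡.trans (≡.cong₂ ℕ._+_
          (#prefix-cong (toℕ j) λ v v<j → ≡.cong (λ b → not (U v) ∧ (b ∧ (v₀ <ᵇ v))) (<ᵇ-true v<j))
          (#range-false (toℕ j) (n ∸ toℕ j) λ v j≤v →
            ≡.trans (≡.cong (λ b → not (U v) ∧ (b ∧ (v₀ <ᵇ v))) (<ᵇ-false j≤v)) (∧-zeroʳ _)))
          (ℕₚ.+-identityʳ _)))

-- Summation over the colourings of a fixed permutation

module Colour {e ℓ} (R : CommutativeRing e ℓ) where
  open CommutativeRing R hiding (zero)
  open PowerSeries R
  open RangeSum +-commutativeMonoid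
  open Transfer R using (sumᴸ-*ˡ)
  open import Algebra.Properties.CommutativeMonoid.Sum *-commutativeMonoid using ()
    renaming (sum-cong-≋ to product-cong)
  open import Relation.Binary.Reasoning.Setoid setoid

  sumᴸ-*ʳ : ∀ {A : Set} k (xs : List A) F → sumᴸ xs (λ x → F x * k) ≈ sumᴸ xs F * k
  sumᴸ-*ʳ k []       F = sym (zeroˡ k)
  sumᴸ-*ʳ k (x ∷ xs) F = trans (+-congˡ (sumᴸ-*ʳ k xs F)) (sym (distribʳ k _ _))

  -- The distributive law: a product of sums expands into one product for each choice function.
  sum-choices : ∀ {n} {B : Fin n → Set} (xss : ∀ i → List (B i)) (F : ∀ i → B i → Carrier) →
                sumᴸ (choices xss) (λ φ → product (λ i → F i (φ i))) ≈ product (λ i → sumᴸ (xss i) (F i))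
  sum-choices {zero}  xss F = +-identityʳ 1#
  sum-choices {suc n} {B} xss F = begin
    sumᴸ (choices xss) (λ φ → product (λ i → F i (φ i)))
      ≈⟨ sumᴸ-cartesianProductWith (∀-cons {P = B}) (xss zero) (choices (xss ∘ suc)) _ ⟩
    sumᴸ (xss zero) (λ y → sumᴸ (choices (xss ∘ suc)) (λ φ → F zero y * product (λ i → F (suc i) (φ i))))
      ≈⟨ sumᴸ-cong (xss zero) (λ y → sumᴸ-*ˡ _ (choices (xss ∘ suc)) _) ⟩
    sumᴸ (xss zero) (λ y → F zero y * sumᴸ (choices (xss ∘ suc)) (λ φ → product (λ i → F (suc i) (φ i))))
      ≈⟨ sumᴸ-*ʳ _ (xss zero) _ ⟩
    sumᴸ (xss zero) (F zero) * sumᴸ (choices (xss ∘ suc)) (λ φ → product (λ i → F (suc i) (φ i)))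
      ≈⟨ *-congˡ (sum-choices (xss ∘ suc) (λ i → F (suc i))) ⟩
    product (λ i → sumᴸ (xss i) (F i)) ∎

  -- Off the fixed points there is a single vacuous colouring, which contributes `1#`.
  sum-ifHolds : ∀ {P : Set} (P? : Dec P) {k} (u : Fin k → Carrier) →
                sumᴸ (ifHolds P? (allFin k)) (λ y → colourFactor P? (u ∘ y)) ≈ colourFactor P? (λ _ → ∑[ j < k ] u j)
  sum-ifHolds (yes _) {k} u = reflexive (≡.trans (sumᴸ-map _ (allFin k) _) (sumᴸ-tabulate {n = k} id u))
  sum-ifHolds (no _)      u = +-identityʳ 1#

  -- Fixed points are coloured independently, so each collects the sum of all `u j`. This reduces
  -- arrangements to permutations.
  sum-col : ∀ {n k} (π : Permutation′ n) (u : Fin k → Carrier) →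
            sumᴸ (colourings k π) (λ φ → col u (π , φ)) ≈ product (λ i → colourFactor (π ⟨$⟩ʳ i Finₚ.≟ i) (λ _ → ∑[ j < k ] u j))
  sum-col {n} {k} π u = begin
    sumᴸ (colourings k π) (λ φ → col u (π , φ))
      ≈⟨ reflexive (sumᴸ-map uncurry (choices xss) _) ⟩
    sumᴸ (choices xss) (λ φ → product (λ i → colourFactor (π ⟨$⟩ʳ i Finₚ.≟ i) (u ∘ φ i)))
      ≈⟨ sum-choices xss (λ i y → colourFactor (π ⟨$⟩ʳ i Finₚ.≟ i) (u ∘ y)) ⟩
    product (λ i → sumᴸ (xss i) (λ y → colourFactor (π ⟨$⟩ʳ i Finₚ.≟ i) (u ∘ y)))
      ≈⟨ product-cong {n} (λ i → sum-ifHolds (π ⟨$⟩ʳ i Finₚ.≟ i) u) ⟩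
    product (λ i → colourFactor (π ⟨$⟩ʳ i Finₚ.≟ i) (λ _ → ∑[ j < k ] u j)) ∎
    where
    xss : ∀ i → List (π ⟨$⟩ʳ i ≡ i → Fin k)
    xss i = ifHolds (π ⟨$⟩ʳ i Finₚ.≟ i) (allFin k)

-- The monomial of a permutation as a product over positions

module Factor {e ℓ} (R : CommutativeRing e ℓ)
              (a b c d f g h l p r s t u w : CommutativeRing.Carrier R) where
  open CommutativeRing R hiding (zero)
  open PowerSeries R
  open RangeSum +-commutativeMonoid
  open Colour R using (sumᴸ-*ʳ)
  open Enumeration R a b c d f g h l p r s t u w using (weight; weight-upper; weight-lower; weight-fixed; run)
  open import Algebra.Properties.CommutativeMonoid.Sum *-commutativeMonoid using ()
    renaming (sum-cong-≋ to product-cong; ∑-distrib-+ to product-*)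
  open import Algebra.Properties.Semiring.Exp semiring using (^-homo-*)
  open import Algebra.Solver.CommutativeMonoid *-commutativeMonoid using (solve; _⊜_) renaming (id to 𝟏; _⊕_ to infixl 6 _⊗_)
  open import Relation.Binary.Reasoning.Setoid setoid

  run-product : ∀ N j U τ →
    run N j U τ ≈ product {N} (λ i → weight (N ∸ suc (toℕ i)) (j ℕ.+ toℕ i) (used U τ i) (τ i))
  run-product zero    j U τ = refl
  run-product (suc N) j U τ = *-cong
    (reflexive (≡.cong (λ k → weight N k U (τ zero)) (≡.sym (ℕₚ.+-identityʳ j))))
    (trans (run-product N (suc j) (add (τ zero) U) (τ ∘ suc)) (product-cong {N} λ i →
      reflexive (≡.cong (λ k → weight (N ∸ suc (toℕ i)) k (used U τ (suc i)) (τ (suc i))) (≡.sym (ℕₚ.+-suc j (toℕ i))))))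

  ^-sum : ∀ x {n} (k : Fin n → ℕ) → x ^ sumℕ k ≈ product (λ i → x ^ k i)
  ^-sum x {zero}  k = refl
  ^-sum x {suc n} k = trans (^-homo-* x (k zero) _) (*-congˡ (^-sum x (k ∘ suc)))

  -- up, lin, dn, alin and fix tell how a position compares with its value and
  -- its preimage; x is its colour factor, and E, D, E′, D′ count the pairs that
  -- contribute to the statistics at this position.
  factor : (up lin dn alin fix : Bool) → Carrier → (E D E′ D′ : ℕ) → Carrier
  factor up lin dn alin fix x E D E′ D′ =
    x * a ^ (E when up ∧ lin) * b ^ (D when up ∧ lin)
      * c ^ (E when up ∧ not lin) * d ^ (D when up ∧ not lin)
      * f ^ (E′ when dn ∧ alin) * g ^ (D′ when dn ∧ alin)
      * h ^ (E′ when dn ∧ not alin) * l ^ (D′ when dn ∧ not alin)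
      * p ^ ⟦ up ∧ not lin ⟧ * r ^ ⟦ dn ∧ not alin ⟧
      * s ^ ⟦ up ∧ lin ⟧ * t ^ ⟦ dn ∧ alin ⟧
      * w ^ (E when fix)

  factor-up : ∀ lin alin E D E′ D′ → factor true lin false alin false 1# E D E′ D′ ≈
              (if lin then s * (a ^ E * b ^ D) else p * (c ^ E * d ^ D))
  factor-up true  alin E D E′ D′ = solve 3 (λ x y z →
    𝟏 ⊗ x ⊗ y ⊗ 𝟏 ⊗ 𝟏 ⊗ 𝟏 ⊗ 𝟏 ⊗ 𝟏 ⊗ 𝟏 ⊗ 𝟏 ⊗ 𝟏 ⊗ (z ⊗ 𝟏) ⊗ 𝟏 ⊗ 𝟏 ⊜ z ⊗ (x ⊗ y)) refl (a ^ E) (b ^ D) s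
  factor-up false alin E D E′ D′ = solve 3 (λ x y z →
    𝟏 ⊗ 𝟏 ⊗ 𝟏 ⊗ x ⊗ y ⊗ 𝟏 ⊗ 𝟏 ⊗ 𝟏 ⊗ 𝟏 ⊗ (z ⊗ 𝟏) ⊗ 𝟏 ⊗ 𝟏 ⊗ 𝟏 ⊗ 𝟏 ⊜ z ⊗ (x ⊗ y)) refl (c ^ E) (d ^ D) p

  -- `alin` is `not lin` here: a position with a smaller value is not fixed, so it differs from its
  -- preimage.
  factor-down : ∀ lin E D E′ D′ → factor false lin true (not lin) false 1# E D E′ D′ ≈
                (if lin then r * (h ^ E′ * l ^ D′) else t * (f ^ E′ * g ^ D′))
  factor-down true  E D E′ D′ = solve 3 (λ x y z →
    𝟏 ⊗ 𝟏 ⊗ 𝟏 ⊗ 𝟏 ⊗ 𝟏 ⊗ 𝟏 ⊗ 𝟏 ⊗ x ⊗ y ⊗ 𝟏 ⊗ (z ⊗ 𝟏) ⊗ 𝟏 ⊗ 𝟏 ⊗ 𝟏 ⊜ z ⊗ (x ⊗ y)) refl (h ^ E′) (l ^ D′) r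
  factor-down false E D E′ D′ = solve 3 (λ x y z →
    𝟏 ⊗ 𝟏 ⊗ 𝟏 ⊗ 𝟏 ⊗ 𝟏 ⊗ x ⊗ y ⊗ 𝟏 ⊗ 𝟏 ⊗ 𝟏 ⊗ 𝟏 ⊗ 𝟏 ⊗ (z ⊗ 𝟏) ⊗ 𝟏 ⊜ z ⊗ (x ⊗ y)) refl (f ^ E′) (g ^ D′) t

  factor-fixed : ∀ lin alin E D E′ D′ → factor false lin false alin true u E D E′ D′ ≈ u * w ^ E
  factor-fixed lin alin E D E′ D′ = solve 2 (λ x y →
    x ⊗ 𝟏 ⊗ 𝟏 ⊗ 𝟏 ⊗ 𝟏 ⊗ 𝟏 ⊗ 𝟏 ⊗ 𝟏 ⊗ 𝟏 ⊗ 𝟏 ⊗ 𝟏 ⊗ 𝟏 ⊗ 𝟏 ⊗ y ⊜ x ⊗ y) refl u (w ^ E)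

  colourFactor-yes : ∀ {P : Set} (P? : Dec P) → P → colourFactor P? (λ _ → u) ≡ u
  colourFactor-yes (yes _) _ = ≡.refl
  colourFactor-yes (no ¬p) q = contradiction q ¬p

  colourFactor-no : ∀ {P : Set} (P? : Dec P) → ¬ P → colourFactor P? (λ _ → u) ≡ 1#
  colourFactor-no (yes q) ¬p = contradiction q ¬p
  colourFactor-no (no _)  _  = ≡.refl

  monomial : ∀ {n} → Permutation′ n → Carrier → Carrier
  monomial σ x =
    x * a ^ ile σ * b ^ nile σ
      * c ^ (ie σ ∸ ile σ) * d ^ (nie σ ∸ nile σ)
      * f ^ ilae σ * g ^ nilae σ
      * h ^ (iae σ ∸ ilae σ) * l ^ (niae σ ∸ nilae σ)
      * p ^ (exc σ ∸ le σ) * r ^ (aexc σ ∸ lae σ)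
      * s ^ le σ * t ^ lae σ
      * w ^ iefp σ

  -- `monomial σ` is linear in its argument; each `_∙_` takes one power out of the sum.
  sumᴸ-monomial : ∀ {n} (σ : Permutation′ n) {A : Set} (xs : List A) {F x} → sumᴸ xs F ≈ x →
                  sumᴸ xs (λ y → monomial σ (F y)) ≈ monomial σ x
  sumᴸ-monomial σ xs F≈x = F≈x ∙ _ ∙ _ ∙ _ ∙ _ ∙ _ ∙ _ ∙ _ ∙ _ ∙ _ ∙ _ ∙ _ ∙ _ ∙ _
    where
    infixl 5 _∙_
    _∙_ : ∀ {G x} → sumᴸ xs G ≈ x → ∀ y → sumᴸ xs (λ z → G z * y) ≈ x * y
    G≈x ∙ y = trans (sumᴸ-*ʳ y xs _) (*-congʳ G≈x)

  module _ {n} (σ : Permutation′ n) where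
    open Statistics σ

    colour-of : Fin n → Carrier
    colour-of j = colourFactor (σ ⟨$⟩ʳ j Finₚ.≟ j) (λ _ → u)

    position : Fin n → Carrier
    position j = factor (up j) (lin j) (dn j) (alin j) (fix j) (colour-of j)
                        (nested j) (crossed j) (anested j) (acrossed j)

    j≡σ⁻j⇒j≡σj : ∀ {j} → toℕ j ≡ toℕ (σ ⟨$⟩ˡ j) → toℕ j ≡ toℕ (σ ⟨$⟩ʳ j)
    j≡σ⁻j⇒j≡σj eq = ≡.cong toℕ (≡.trans (≡.sym (Perm.inverseʳ σ)) (≡.cong (σ ⟨$⟩ʳ_) (≡.sym (toℕ-injective eq))))

    weight-at-fixed : ∀ j → toℕ j ≡ toℕ (σ ⟨$⟩ʳ j) →
      weight (n ∸ suc (toℕ j)) (toℕ j) (usedBefore j) (toℕ (σ ⟨$⟩ʳ j)) ≡ u * w ^ nested j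
    weight-at-fixed j j≡v = ≡.trans (≡.cong (weight N (toℕ j) U) (≡.sym j≡v))
      (≡.trans (weight-fixed N (toℕ j) U) (≡.cong (λ k → u * w ^ k) (≡.sym (≡.trans
        (nested-range j (ℕₚ.≤-reflexive j≡v))
        (#range-cong (suc (toℕ j)) N λ v j<v →
          ≡.trans (≡.cong (U v ∧_) (<ᵇ-true (≡.subst (ℕ._< v) j≡v j<v))) (∧-identityʳ (U v)))))))
      where
      U = usedBefore j
      N = n ∸ suc (toℕ j)

    -- Comparing `j` with `σ j` selects the branch of `weight`. Its test on `U j` becomes `lin j`,
    -- and the exponents in `upper` and `lower` become the counts of pairs charged to `j`.
    position-weight : ∀ j → position j ≈ weight (n ∸ suc (toℕ j)) (toℕ j) (usedBefore j) (toℕ (σ ⟨$⟩ʳ j))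
    position-weight j with ℕₚ.<-cmp (toℕ j) (toℕ (σ ⟨$⟩ʳ j))
    ... | tri< j<v j≢v _
      rewrite weight-upper (n ∸ suc (toℕ j)) (toℕ j) (usedBefore j) (toℕ (σ ⟨$⟩ʳ j)) j<v
            | <ᵇ-true j<v | <ᵇ-false (ℕₚ.<⇒≤ j<v)
            | dec-false (j Finₚ.≟ σ ⟨$⟩ʳ j) (j≢v ∘ ≡.cong toℕ)
            | colourFactor-no (σ ⟨$⟩ʳ j Finₚ.≟ j) (j≢v ∘ ≡.sym ∘ ≡.cong toℕ)
            | usedBefore-self j | nested-range j (ℕₚ.<⇒≤ j<v) | crossed-range j
      = factor-up (lin j) (alin j) _ _ (anested j) (acrossed j)
    ... | tri≈ _ j≡v _ = trans
      (begin
        position j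
          ≡⟨ factor-cong (<ᵇ-false (ℕₚ.≤-reflexive (≡.sym j≡v))) (<ᵇ-false (ℕₚ.≤-reflexive j≡v))
               (dec-true (j Finₚ.≟ σ ⟨$⟩ʳ j) (toℕ-injective j≡v))
               (colourFactor-yes (σ ⟨$⟩ʳ j Finₚ.≟ j) (≡.sym (toℕ-injective j≡v))) ⟩
        factor false (lin j) false (alin j) true u (nested j) (crossed j) (anested j) (acrossed j)
          ≈⟨ factor-fixed (lin j) (alin j) (nested j) (crossed j) (anested j) (acrossed j) ⟩
        u * w ^ nested j ∎)
      (reflexive (≡.sym (weight-at-fixed j j≡v)))
      where
      factor-cong : ∀ {up up′ dn dn′ fix fix′ x x′} → up ≡ up′ → dn ≡ dn′ → fix ≡ fix′ → x ≡ x′ →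
        factor up (lin j) dn (alin j) fix x (nested j) (crossed j) (anested j) (acrossed j)
          ≡ factor up′ (lin j) dn′ (alin j) fix′ x′ (nested j) (crossed j) (anested j) (acrossed j)
      factor-cong ≡.refl ≡.refl ≡.refl ≡.refl = ≡.refl
    ... | tri> _ j≢v v<j
      rewrite weight-lower (n ∸ suc (toℕ j)) (toℕ j) (usedBefore j) (toℕ (σ ⟨$⟩ʳ j)) v<j
            | <ᵇ-true v<j | <ᵇ-false (ℕₚ.<⇒≤ v<j)
            | dec-false (j Finₚ.≟ σ ⟨$⟩ʳ j) (j≢v ∘ ≡.cong toℕ)
            | colourFactor-no (σ ⟨$⟩ʳ j Finₚ.≟ j) (j≢v ∘ ≡.sym ∘ ≡.cong toℕ)
            | usedBefore-self j | anested-prefix j (ℕₚ.<⇒≤ v<j) | acrossed-prefix j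
            -- Turns `alin j` into `not (lin j)`; were `j` its own preimage, it would be a fixed
            -- point.
            | <ᵇ-flip {toℕ j} {toℕ (σ ⟨$⟩ˡ j)} (j≢v ∘ j≡σ⁻j⇒j≡σj)
      = factor-down (lin j) (nested j) (crossed j) _ _

    run-position : run n 0 (λ _ → false) (λ i → toℕ (σ ⟨$⟩ʳ i)) ≈ product position
    run-position = trans (run-product n 0 _ _) (product-cong {n} λ j → sym (position-weight j))

    -- Every exponent is a sum over positions, so every power is a product over positions, and these
    -- products are merged one by one.
    monomial-product : monomial σ (product colour-of) ≈ product position
    monomial-product =
      (refl ∙ ile-sum ∙ nile-sum ∙ ie∸ile-sum ∙ nie∸nile-sum ∙ ilae-sum ∙ nilae-sum
        ∙ iae∸ilae-sum ∙ niae∸nilae-sum ∙ exc∸le-sum ∙ aexc∸lae-sum ∙ le-sum ∙ lae-sum ∙ iefp-sum)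
      where
      infixl 5 _∙_
      _∙_ : ∀ {y F x k} {e : Fin n → ℕ} → y ≈ product F → k ≡ sumℕ e → y * x ^ k ≈ product (λ j → F j * x ^ e j)
      _∙_ {F = F} {x} {e = e} y≈F ≡.refl = trans (*-cong y≈F (^-sum x e)) (sym (product-* F (λ j → x ^ e j)))

proposition1 : ∀ {e ε} (R : CommutativeRing e ε) →
    let open CommutativeRing R
        open PowerSeries R
    in
    (a b c d f g h l p r s t w : Carrier) (k : ℕ) (u : Fin k → Carrier) →
    𝒞 a b c d f g h l p r s t (∑[ j < k ] u j) w
      ≋ λ n → ∑𝔸 n k λ 𝔞 → let σ = perm 𝔞 in
          col u 𝔞
            * a ^ ile σ * b ^ nile σ
            * c ^ (ie σ ∸ ile σ) * d ^ (nie σ ∸ nile σ)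
            * f ^ ilae σ * g ^ nilae σ
            * h ^ (iae σ ∸ ilae σ) * l ^ (niae σ ∸ nilae σ)
            * p ^ (exc σ ∸ le σ) * r ^ (aexc σ ∸ lae σ)
            * s ^ le σ * t ^ lae σ
            * w ^ iefp σ
proposition1 R a b c d f g h l p r s t w k u n = begin
  𝒞 a b c d f g h l p r s t 𝐮 w n
    ≈⟨ continuedFraction-paths _ up down (𝒞-β c d h l p r)
         -- `p` and the bracket in `c, d` go to the up step, `r` and the bracket in `h, l` to the
         -- down step.
         (λ m → solve 4 (λ p r x y → p ⊗ r ⊗ x ⊗ y ⊜ (p ⊗ x) ⊗ (r ⊗ y)) refl p r [ m ]⟨ c , d ⟩ [ m ]⟨ h , l ⟩) n ⟩
  paths (𝒞-α a b f g s t 𝐮 w) up down n 0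
    ≈⟨ sum-run-paths n ⟨
  sumᴸ (permutations n) (λ π → run n 0 ∅ (λ i → toℕ (π ⟨$⟩ʳ i)))
    ≈⟨ sumᴸ-cong (permutations n) (λ π → begin
         run n 0 ∅ (λ i → toℕ (π ⟨$⟩ʳ i))                ≈⟨ run-position π ⟩
         product (position π)                            ≈⟨ monomial-product π ⟨
         monomial π (product (colour-of π))              ≈⟨ sumᴸ-monomial π (colourings k π) (sum-col π u) ⟨
         sumᴸ (colourings k π) (λ φ → F (π , φ))         ∎) ⟩
  sumᴸ (permutations n) (λ π → sumᴸ (colourings k π) (λ φ → F (π , φ)))
    ≈⟨ sumᴸ-cong (permutations n) (λ π → reflexive (sumᴸ-map (π ,_) (colourings k π) F)) ⟨
  sumᴸ (permutations n) (λ π → sumᴸ (map (π ,_) (colourings k π)) F)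
    ≈⟨ sumᴸ-concatMap _ (permutations n) F ⟨
  ∑𝔸 n k F ∎
  where
  open CommutativeRing R
  open PowerSeries R
  open Motzkin R using (paths; continuedFraction-paths)
  open RangeSum +-commutativeMonoid
  open Colour R
  open Algebra.Solver.CommutativeMonoid *-commutativeMonoid using (solve; _⊜_) renaming (_⊕_ to infixl 6 _⊗_)
  open Relation.Binary.Reasoning.Setoid setoid
  𝐮 = ∑[ j < k ] u j
  -- With `u` specialised to `𝐮`, a fixed point of a permutation carries the total weight of its
  -- possible colours.
  open Enumeration R a b c d f g h l p r s t 𝐮 w
  open Factor R a b c d f g h l p r s t 𝐮 w

  F : Arrangement n k → Carrier
  F 𝔞 = monomial (perm 𝔞) (col u 𝔞)
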